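{- For each positive integer $d$, there exists a constant $\gamma_d>0$ such that the following holds. If $A\subseteq\mathbb{R}^d$ is an $m$-element set with no linearly dependent $d$-element subsets, then $A$ has at least $\gamma_d m^{d+1}$ distinct subset sums.
   Context: A subset sum of a finite set $A\subseteq\mathbb{R}^d$ is a vector of the form $\sum_{v\in B}v$ with $B\subseteq A$ (the empty subset is allowed, giving the sum $0$). Linear dependence is over $\mathbb{R}$. The constant $\gamma_d$ depends only on $d$, not on $m$ or $A$. -}

module Defs where

open import Algebra.Bundles using (CommutativeMonoid; RawMonoid)
import Algebra.Definitions.RawMonoid as RawMonoidDefs
import Algebra.Properties.CommutativeSemigroup as CommutativeSemigroupProperties
import Algebra.Properties.Group as GroupProperties
import Algebra.Properties.Ring as RingProperties
open import Data.Bool.Base using (if_then_else_)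
open import Data.Fin.Base using (Fin)
open import Data.Fin.Subset using (Subset; _∈_)
open import Data.Integer.Base using (+_)
open import Data.Nat.Base as ℕ using (ℕ; _⊔_)
import Data.Nat.Properties as ℕ
open import Data.Product.Base using (_×_; _,_; ∃-syntax; Σ-syntax)
open import Data.Rational.Base as ℚ using (ℚ; 0ℚ; 1ℚ; ½; Positive; ∣_∣; 1/_)
import Data.Rational.Properties as ℚ
open import Data.Vec.Base using (lookup)
open import Data.Vec.Functional using (Vector)
open import Data.Vec.Functional.Relation.Binary.Pointwise using (Pointwise)
open import Function.Definitions using (Injective)
open import Level using (0ℓ)
open import Relation.Binary.PropositionalEquality using (_≡_; refl; sym; cong; cong₂; subst; module ≡-Reasoning)
open import Relation.Nullary.Negation using (¬_)

------------------------------------------------------------------------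
-- Real numbers: Cauchy sequences of rationals, with _≈_ as equality

Cauchy : (ℕ → ℚ) → Set
Cauchy s = ∀ ε → 0ℚ ℚ.< ε →
  ∃[ N ] ∀ m n → N ℕ.≤ m → N ℕ.≤ n → ∣ s m ℚ.- s n ∣ ℚ.< ε

record ℝ : Set where
  constructor mkℝ
  field
    seq    : ℕ → ℚ
    cauchy : Cauchy seq

open ℝ public

infix 4 _≈_ _<_ _≤_

_≈_ : ℝ → ℝ → Set
x ≈ y = ∀ ε → 0ℚ ℚ.< ε →
  ∃[ N ] ∀ n → N ℕ.≤ n → ∣ seq x n ℚ.- seq y n ∣ ℚ.< ε

-- The uniform gap ε makes this the order of the limits; eventual
-- termwise comparison alone would not respect _≈_.
_<_ : ℝ → ℝ → Set
x < y = Σ[ ε ∈ ℚ ] (0ℚ ℚ.< ε ×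
  ∃[ N ] ∀ n → N ℕ.≤ n → seq x n ℚ.+ ε ℚ.≤ seq y n)

_≤_ : ℝ → ℝ → Set
x ≤ y = ¬ (y < x)

fromℚ : ℚ → ℝ
fromℚ q = mkℝ (λ _ → q) λ ε 0<ε → 0 , λ _ _ _ _ →
  subst (λ p → ∣ p ∣ ℚ.< ε) (sym (ℚ.+-inverseʳ q)) 0<ε

fromℕ : ℕ → ℝ
fromℕ n = fromℚ (+ n ℚ./ 1)

0ℝ : ℝ
0ℝ = fromℚ 0ℚ

private
  open CommutativeSemigroupProperties
    (CommutativeMonoid.commutativeSemigroup ℚ.+-0-commutativeMonoid)
    using (interchange)
  open GroupProperties ℚ.+-0-group using (//-rightDividesˡ)
  open RingProperties ℚ.+-*-ring using (x[y-z]≈xy-xz; [y-z]x≈yx-zx)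

  half : ∀ ε → 0ℚ ℚ.< ε → 0ℚ ℚ.< ½ ℚ.* ε
  half ε 0<ε = ℚ.positive⁻¹ (½ ℚ.* ε) {{ℚ.pos*pos⇒pos ½ ε {{ℚ.positive 0<ε}}}}

  half+half : ∀ ε → ½ ℚ.* ε ℚ.+ ½ ℚ.* ε ≡ ε
  half+half ε = begin
    ½ ℚ.* ε ℚ.+ ½ ℚ.* ε  ≡⟨ ℚ.*-distribʳ-+ ε ½ ½ ⟨
    1ℚ ℚ.* ε             ≡⟨ ℚ.*-identityˡ ε ⟩
    ε                    ∎
    where open ≡-Reasoning

  abstract
    +-cauchy : ∀ s t → Cauchy s → Cauchy t → Cauchy (λ n → s n ℚ.+ t n)
    +-cauchy s t cs ct ε 0<ε
      with M , p ← cs (½ ℚ.* ε) (half ε 0<ε)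
         | N , q ← ct (½ ℚ.* ε) (half ε 0<ε) =
      M ⊔ N , λ m n hm hn → begin-strict
        ∣ (s m ℚ.+ t m) ℚ.- (s n ℚ.+ t n) ∣
          ≡⟨ cong ∣_∣ (regroup (s m) (t m) (s n) (t n)) ⟩
        ∣ (s m ℚ.- s n) ℚ.+ (t m ℚ.- t n) ∣
          ≤⟨ ℚ.∣p+q∣≤∣p∣+∣q∣ (s m ℚ.- s n) (t m ℚ.- t n) ⟩
        ∣ s m ℚ.- s n ∣ ℚ.+ ∣ t m ℚ.- t n ∣
          <⟨ ℚ.+-mono-< (p m n (ℕ.m⊔n≤o⇒m≤o M N hm) (ℕ.m⊔n≤o⇒m≤o M N hn))
                        (q m n (ℕ.m⊔n≤o⇒n≤o M N hm) (ℕ.m⊔n≤o⇒n≤o M N hn)) ⟩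
        ½ ℚ.* ε ℚ.+ ½ ℚ.* ε
          ≡⟨ half+half ε ⟩
        ε ∎
      where
      open ℚ.≤-Reasoning
      regroup : ∀ a b c d → (a ℚ.+ b) ℚ.- (c ℚ.+ d) ≡ (a ℚ.- c) ℚ.+ (b ℚ.- d)
      regroup a b c d rewrite ℚ.neg-distrib-+ c d = interchange a b (ℚ.- c) (ℚ.- d)

  bounded : ∀ {s} → Cauchy s →
    Σ[ K ∈ ℚ ] (Positive K × ∃[ N ] ∀ n → N ℕ.≤ n → ∣ s n ∣ ℚ.≤ K)
  bounded {s} cs with N , p ← cs 1ℚ (ℚ.positive⁻¹ 1ℚ) =
      1ℚ ℚ.+ ∣ s N ∣
    , ℚ.pos+nonNeg⇒pos 1ℚ ∣ s N ∣ {{ℚ.∣-∣-nonNeg (s N)}}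
    , N , λ n hn → begin
      ∣ s n ∣
        ≡⟨ cong ∣_∣ (//-rightDividesˡ (s N) (s n)) ⟨
      ∣ (s n ℚ.- s N) ℚ.+ s N ∣
        ≤⟨ ℚ.∣p+q∣≤∣p∣+∣q∣ (s n ℚ.- s N) (s N) ⟩
      ∣ s n ℚ.- s N ∣ ℚ.+ ∣ s N ∣
        ≤⟨ ℚ.+-monoˡ-≤ ∣ s N ∣ (ℚ.<⇒≤ (p n N hn ℕ.≤-refl)) ⟩
      1ℚ ℚ.+ ∣ s N ∣ ∎
    where
    open ℚ.≤-Reasoning

  -- K * (½ ε / K) = ½ ε, so ½ ε / K is small enough for a factor bounded by K.
  scaled : ∀ K → Positive K → ∀ ε → 0ℚ ℚ.< ε →
    Σ[ δ ∈ ℚ ] (0ℚ ℚ.< δ × K ℚ.* δ ≡ ½ ℚ.* ε)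
  scaled K K>0 ε 0<ε =
      1/K ℚ.* (½ ℚ.* ε)
    , ℚ.positive⁻¹ _ {{ℚ.pos*pos⇒pos 1/K {{ℚ.1/pos⇒pos K {{K>0}}}}
                        (½ ℚ.* ε) {{ℚ.positive (half ε 0<ε)}}}}
    , (begin
      K ℚ.* (1/K ℚ.* (½ ℚ.* ε))  ≡⟨ ℚ.*-assoc K 1/K (½ ℚ.* ε) ⟨
      (K ℚ.* 1/K) ℚ.* (½ ℚ.* ε)  ≡⟨ cong (ℚ._* (½ ℚ.* ε)) (ℚ.*-inverseʳ K {{nz}}) ⟩
      1ℚ ℚ.* (½ ℚ.* ε)           ≡⟨ ℚ.*-identityˡ (½ ℚ.* ε) ⟩
      ½ ℚ.* ε                    ∎)
    where
    open ≡-Reasoning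
    nz = ℚ.pos⇒nonZero K {{K>0}}
    1/K = (1/ K) {{nz}}

  small : ∀ {K} → Positive K → ∀ p q {δ} → ∣ p ∣ ℚ.≤ K → ∣ q ∣ ℚ.< δ →
    ∣ p ℚ.* q ∣ ℚ.< K ℚ.* δ
  small {K} K>0 p q {δ} hp hq = begin-strict
    ∣ p ℚ.* q ∣        ≡⟨ ℚ.∣p*q∣≡∣p∣*∣q∣ p q ⟩
    ∣ p ∣ ℚ.* ∣ q ∣    ≤⟨ ℚ.*-monoʳ-≤-nonNeg ∣ q ∣ {{ℚ.∣-∣-nonNeg q}} hp ⟩
    K ℚ.* ∣ q ∣        <⟨ ℚ.*-monoʳ-<-pos K {{K>0}} hq ⟩
    K ℚ.* δ            ∎
    where open ℚ.≤-Reasoning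

  abstract
    *-cauchy : ∀ s t → Cauchy s → Cauchy t → Cauchy (λ n → s n ℚ.* t n)
    *-cauchy s t cs ct ε 0<ε
      with K , K>0 , A , s≤K ← bounded cs | L , L>0 , B , t≤L ← bounded ct
      with δ , 0<δ , Kδ≡ ← scaled K K>0 ε 0<ε | η , 0<η , Lη≡ ← scaled L L>0 ε 0<ε
      with C , t-close ← ct δ 0<δ | D , s-close ← cs η 0<η =
      (A ⊔ B) ⊔ (C ⊔ D) , λ m n hm hn →
        let hAB = λ {k} (h : (A ⊔ B) ⊔ (C ⊔ D) ℕ.≤ k) → ℕ.m⊔n≤o⇒m≤o (A ⊔ B) (C ⊔ D) h
            hCD = λ {k} (h : (A ⊔ B) ⊔ (C ⊔ D) ℕ.≤ k) → ℕ.m⊔n≤o⇒n≤o (A ⊔ B) (C ⊔ D) h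
        in begin-strict
        ∣ s m ℚ.* t m ℚ.- s n ℚ.* t n ∣
          ≡⟨ cong ∣_∣ (regroup (s m) (t m) (s n) (t n)) ⟩
        ∣ s m ℚ.* (t m ℚ.- t n) ℚ.+ t n ℚ.* (s m ℚ.- s n) ∣
          ≤⟨ ℚ.∣p+q∣≤∣p∣+∣q∣ (s m ℚ.* (t m ℚ.- t n)) (t n ℚ.* (s m ℚ.- s n)) ⟩
        ∣ s m ℚ.* (t m ℚ.- t n) ∣ ℚ.+ ∣ t n ℚ.* (s m ℚ.- s n) ∣
          <⟨ ℚ.+-mono-<
               (small K>0 (s m) (t m ℚ.- t n) (s≤K m (ℕ.m⊔n≤o⇒m≤o A B (hAB hm)))
                 (t-close m n (ℕ.m⊔n≤o⇒m≤o C D (hCD hm)) (ℕ.m⊔n≤o⇒m≤o C D (hCD hn))))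
               (small L>0 (t n) (s m ℚ.- s n) (t≤L n (ℕ.m⊔n≤o⇒n≤o A B (hAB hn)))
                 (s-close m n (ℕ.m⊔n≤o⇒n≤o C D (hCD hm)) (ℕ.m⊔n≤o⇒n≤o C D (hCD hn)))) ⟩
        K ℚ.* δ ℚ.+ L ℚ.* η
          ≡⟨ cong₂ ℚ._+_ Kδ≡ Lη≡ ⟩
        ½ ℚ.* ε ℚ.+ ½ ℚ.* ε
          ≡⟨ half+half ε ⟩
        ε ∎
      where
      open ℚ.≤-Reasoning
      regroup : ∀ a b c d → a ℚ.* b ℚ.- c ℚ.* d ≡ a ℚ.* (b ℚ.- d) ℚ.+ d ℚ.* (a ℚ.- c)
      regroup a b c d = begin-equality
        a ℚ.* b ℚ.- c ℚ.* d
          ≡⟨ cong (ℚ._- c ℚ.* d) (//-rightDividesˡ (a ℚ.* d) (a ℚ.* b)) ⟨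
        (a ℚ.* b ℚ.- a ℚ.* d) ℚ.+ a ℚ.* d ℚ.- c ℚ.* d
          ≡⟨ ℚ.+-assoc (a ℚ.* b ℚ.- a ℚ.* d) (a ℚ.* d) (ℚ.- (c ℚ.* d)) ⟩
        (a ℚ.* b ℚ.- a ℚ.* d) ℚ.+ (a ℚ.* d ℚ.- c ℚ.* d)
          ≡⟨ cong₂ ℚ._+_ (x[y-z]≈xy-xz a b d) ([y-z]x≈yx-zx d a c) ⟨
        a ℚ.* (b ℚ.- d) ℚ.+ (a ℚ.- c) ℚ.* d
          ≡⟨ cong (a ℚ.* (b ℚ.- d) ℚ.+_) (ℚ.*-comm (a ℚ.- c) d) ⟩
        a ℚ.* (b ℚ.- d) ℚ.+ d ℚ.* (a ℚ.- c) ∎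

infixl 6 _+_
infixl 7 _*_

_+_ : ℝ → ℝ → ℝ
mkℝ s cs + mkℝ t ct = mkℝ (λ n → s n ℚ.+ t n) (+-cauchy s t cs ct)

_*_ : ℝ → ℝ → ℝ
mkℝ s cs * mkℝ t ct = mkℝ (λ n → s n ℚ.* t n) (*-cauchy s t cs ct)

+-0-rawMonoid : RawMonoid 0ℓ 0ℓ
+-0-rawMonoid = record { Carrier = ℝ ; _≈_ = _≈_ ; _∙_ = _+_ ; ε = 0ℝ }

open RawMonoidDefs +-0-rawMonoid public using (sum)

------------------------------------------------------------------------
-- Finite sets of vectors in ℝᵈ

infix 8 ℝ^_
infix 4 _≈ᵛ_

ℝ^_ : ℕ → Set
ℝ^ d = Vector ℝ d

_≈ᵛ_ : ∀ {d} → ℝ^ d → ℝ^ d → Set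
_≈ᵛ_ = Pointwise _≈_

-- An m-element set is given by an enumeration a : Fin m → ℝ^ d without
-- repetitions; its subsets are then the {a i | i ∈ B} with B : Subset m.
Distinct : ∀ {d m} → (Fin m → ℝ^ d) → Set
Distinct = Injective _≡_ _≈ᵛ_

subsetSum : ∀ {d m} → (Fin m → ℝ^ d) → Subset m → ℝ^ d
subsetSum a B j = sum (λ i → if lookup B i then a i j else 0ℝ)

IsSubsetSum : ∀ {d m} → (Fin m → ℝ^ d) → ℝ^ d → Set
IsSubsetSum a v = ∃[ B ] v ≈ᵛ subsetSum a B

LinearlyDependent : ∀ {d m} → (Fin m → ℝ^ d) → Subset m → Set
LinearlyDependent {d} {m} a B = Σ[ c ∈ (Fin m → ℝ) ]
  ((∃[ i ] (i ∈ B × ¬ (c i ≈ 0ℝ))) ×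
   subsetSum (λ i j → c i * a i j) B ≈ᵛ (λ _ → 0ℝ))

HasAtLeast : ∀ {d} → ℝ → (ℝ^ d → Set) → Set
HasAtLeast {d} r P = ∃[ N ] (r ≤ fromℕ N ×
  Σ[ v ∈ (Fin N → ℝ^ d) ] (Distinct v × (∀ k → P (v k))))

{-# OPTIONS --safe #-}

module Submission where

open import Algebra.Bundles using (AbelianGroup; CommutativeRing)
import Algebra.Construct.Pointwise as Pointwise
import Algebra.Definitions.RawMonoid as RawMonoidDefs
import Algebra.Properties.AbelianGroup as AbelianGroupProperties
import Algebra.Properties.CommutativeSemigroup as CommutativeSemigroupProperties
import Algebra.Properties.Monoid.Mult as Mult
import Algebra.Properties.Ring as RingProperties
import Algebra.Properties.Semiring.Mult as SemiringMult
import Algebra.Solver.Ring as RingSolver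
import Algebra.Solver.Ring.AlmostCommutativeRing as ACR
open import Axiom.ExcludedMiddle using (ExcludedMiddle)
open import Data.Bool.Base using (Bool; true; false; if_then_else_)
open import Data.Fin.Base using (Fin; zero; suc; punchIn; punchOut)
import Data.Fin.Properties as Fin
open import Data.Fin.Subset as Subset using (Subset; outside; inside)
open import Data.Integer.Base as ℤ using (ℤ; -[1+_]; _⊖_; 0ℤ)
import Data.Integer.Properties as ℤ
open import Data.List.Base as List using (List; []; _∷_; _++_; length; map; foldr; filter; tabulate)
open import Data.List.Membership.Propositional using (_∈_; find)
open import Data.List.Membership.Propositional.Properties using (∈-∃++; ∈-lookup)
open import Data.List.Properties using (length-++; length-map; length-tabulate; filter-++; filter-some)
open import Data.List.Relation.Binary.Permutation.Propositional as ↭ using (_↭_; prep; swap)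
open import Data.List.Relation.Binary.Permutation.Propositional.Properties using (All-resp-↭; ↭-length; shift)
import Data.List.Relation.Binary.Permutation.Setoid.Properties as PermutationSetoid
open import Data.List.Relation.Binary.Sublist.Propositional as Sublist using (_⊆_; []; _∷_; _∷ʳ_)
open import Data.List.Relation.Binary.Sublist.Propositional.Properties using (filter-⊆; All-resp-⊆)
import Data.List.Relation.Binary.Sublist.Propositional.Properties as Sublist
open import Data.List.Relation.Unary.All as All using (All; []; _∷_)
import Data.List.Relation.Unary.All.Properties as All
open import Data.List.Relation.Unary.AllPairs as AllPairs using (AllPairs; []; _∷_)
import Data.List.Relation.Unary.AllPairs.Properties as AllPairs
open import Data.List.Relation.Unary.Any using (here; there; any?)
import Data.List.Relation.Unary.Any.Properties as Any
open import Data.Maybe.Base as Maybe using (Maybe)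
open import Data.Nat.Base as ℕ using (ℕ; zero; suc; _^_; z≤n; s≤s; NonZero)
import Data.Nat.Properties as ℕ
open import Data.Product.Base using (Σ-syntax; ∃-syntax; _×_; _,_; proj₁; proj₂)
open import Data.Rational.Base as ℚ using (ℚ; 0ℚ; 1ℚ; ½)
import Data.Rational.Properties as ℚ
import Data.Rational.Solver as ℚSolver
open import Data.Rational.Unnormalised.Base as ℚᵘ using (mkℚᵘ; *≤*; *<*)
import Data.Rational.Unnormalised.Properties as ℚᵘ
open import Data.Sum.Base using (_⊎_; inj₁; inj₂; [_,_]′)
open import Data.Vec.Base using (lookup; []; _∷_; here; there)
import Data.Vec.Functional as Vector
open import Function.Base using (_∘_; _$_)
open import Level using (0ℓ)
open import Relation.Binary.Definitions using (Symmetric)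
open import Relation.Binary.PropositionalEquality as ≡ using (_≡_; cong; subst; subst₂)
open import Relation.Nullary.Decidable using (yes; no; ¬?; decidable-stable; dec⇒maybe)
open import Relation.Nullary.Negation using (¬_; contradiction)
open import Relation.Unary using (Decidable)

-- Let v ∈ A be nonzero and let φ be a linear map with φ v = 0. In every fibre of φ
-- over a subset sum of φ(A ∖ v) the last sum of a chain s, s + v, s + 2v, … of sums of
-- A ∖ v becomes a new sum when v is added to it, so A has at least |S(φ(A ∖ v))| more
-- sums than A ∖ v, where S denotes the set of subset sums. If φ is the projection
-- along v, then φ(A ∖ v) satisfies the hypothesis in dimension d − 1 and so has at
-- least c mᵈ sums by induction on d; adding these gains over the removal of all
-- elements gives the order m^(d+1).
-- For d = 2 the projections to the line are nonzero but may coincide. A pair a, b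
-- coincides only if a − b is parallel to v, which holds for at most one v ∈ A, so by
-- averaging some v has at most m/2 coinciding pairs and leaves about m/2 distinct
-- values. For d = 1 half of the numbers have the same sign, and among positive
-- numbers the largest one contributes linearly many sums above the total of the rest.

-- Arithmetic of the growth estimates.

module Arithmetic where
  open import Data.Nat.Base using (_+_; _*_; _≤_)
  open import Data.Nat.Properties
  open import Data.Nat.Solver using (module +-*-Solver)

  -- The one-dimensional step: the square grows by `2 * n + 1`, while `suc n` new sums, counted
  -- twice, contribute `2 * n + 2`.
  square-step : ∀ n l → n ^ 2 ≤ 2 * l → suc n ^ 2 ≤ 2 * (l + suc n)
  square-step n l le = begin
    suc n ^ 2              ≡⟨ solve 1 (λ n → (con 1 :+ n) :^ 2 := n :^ 2 :+ (con 2 :* n :+ con 1)) ≡.refl n ⟩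
    n ^ 2 + (2 * n + 1)    ≤⟨ +-mono-≤ le (+-monoʳ-≤ (2 * n) (s≤s z≤n)) ⟩
    2 * l + (2 * n + 2)    ≡⟨ solve 2 (λ l n → con 2 :* l :+ (con 2 :* n :+ con 2) := con 2 :* (l :+ (con 1 :+ n))) ≡.refl l n ⟩
    2 * (l + suc n)        ∎
    where
    open ≤-Reasoning
    open +-*-Solver

  -- Keeping half of the elements costs a factor of four. This turns 2 into 8 when one sign is
  -- chosen, and 8 into 32 when collisions are discarded.
  square-half : ∀ {n k} c l → n ≤ 2 * k → k ^ 2 ≤ c * l → n ^ 2 ≤ (4 * c) * l
  square-half {n} {k} c l n≤2k le = begin
    n ^ 2          ≤⟨ ^-monoˡ-≤ 2 n≤2k ⟩
    (2 * k) ^ 2    ≡⟨ solve 1 (λ k → (con 2 :* k) :^ 2 := con 4 :* k :^ 2) ≡.refl k ⟩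
    4 * k ^ 2      ≤⟨ *-monoʳ-≤ 4 le ⟩
    4 * (c * l)    ≡⟨ *-assoc 4 c l ⟨
    (4 * c) * l    ∎
    where
    open ≤-Reasoning
    open +-*-Solver

  -- A discrete mean value estimate: the increment of a power is at most its derivative at the upper
  -- end point.
  suc-^-≤ : ∀ m k → suc m ^ suc k ≤ m ^ suc k + suc k * suc m ^ k
  suc-^-≤ m zero    = ≤-reflexive (solve 1 (λ m → (con 1 :+ m) :* con 1 := m :* con 1 :+ con 1) ≡.refl m)
    where open +-*-Solver
  suc-^-≤ m (suc k) = begin
    X + m * X                                  ≤⟨ +-monoʳ-≤ X (*-monoʳ-≤ m (suc-^-≤ m k)) ⟩
    X + m * (m ^ suc k + suc k * Y)            ≡⟨ solve 5 (λ x m p q y → x :+ m :* (p :+ q :* y) := (m :* p :+ x) :+ q :* (m :* y)) ≡.refl X m (m ^ suc k) (suc k) Y ⟩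
    (m ^ suc (suc k) + X) + suc k * (m * Y)    ≤⟨ +-monoʳ-≤ (m ^ suc (suc k) + X) (*-monoʳ-≤ (suc k) (m≤n+m (m * Y) Y)) ⟩
    (m ^ suc (suc k) + X) + suc k * X          ≡⟨ +-assoc (m ^ suc (suc k)) X (suc k * X) ⟩
    m ^ suc (suc k) + suc (suc k) * X          ∎
    where
    open ≤-Reasoning
    open +-*-Solver
    Y = suc m ^ k
    X = suc m ^ suc k

  ^-distrib-* : ∀ k m n → (m * n) ^ k ≡ m ^ k * n ^ k
  ^-distrib-* zero    m n = ≡.refl
  ^-distrib-* (suc k) m n = ≡.trans (cong (m * n *_) (^-distrib-* k m n))
    ([m*n]*[o*p]≡[m*o]*[n*p] m n (m ^ k) (n ^ k))

  -- In the first summand `suc k` comes from differencing the power and `2 ^ k` from replacing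
  -- `suc m` by `2 * m`. The summand `c₀` serves the lists on which the recursion stops.
  growthConstant : ℕ → ℕ → ℕ → ℕ
  growthConstant k c c₀ = suc k * (2 ^ k * c) + c₀

  -- Here `f` counts the sums of `m` elements and `g` those gained from one more. The gain pays for
  -- the increment of the power: since `1 ≤ m`, that increment is at most `suc k * (2 ^ k * m ^ k)`.
  growth : ∀ k c c₀ {m} f g → 1 ≤ m → let C = growthConstant k c c₀ in
    m ^ suc k ≤ C * f → m ^ k ≤ c * g → suc m ^ suc k ≤ C * (f + g)
  growth k c c₀ {m} f g 1≤m hf hg = begin
    suc m ^ suc k                         ≤⟨ suc-^-≤ m k ⟩
    m ^ suc k + suc k * suc m ^ k         ≤⟨ +-mono-≤ hf (*-monoʳ-≤ (suc k) double) ⟩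
    C * f + suc k * (2 ^ k * (c * g))     ≡⟨ cong (λ x → C * f + suc k * x) (*-assoc (2 ^ k) c g) ⟨
    C * f + suc k * ((2 ^ k * c) * g)     ≡⟨ cong (λ x → C * f + x) (*-assoc (suc k) (2 ^ k * c) g) ⟨
    C * f + (suc k * (2 ^ k * c)) * g     ≤⟨ +-monoʳ-≤ (C * f) (*-monoˡ-≤ g (m≤m+n (suc k * (2 ^ k * c)) c₀)) ⟩
    C * f + C * g                         ≡⟨ *-distribˡ-+ C f g ⟨
    C * (f + g)                           ∎
    where
    open ≤-Reasoning
    C = growthConstant k c c₀
    double : suc m ^ k ≤ 2 ^ k * (c * g)
    double = begin
      suc m ^ k             ≤⟨ ^-monoˡ-≤ k (+-monoˡ-≤ m 1≤m) ⟩
      (m + m) ^ k           ≡⟨ cong (λ x → (m + x) ^ k) (+-identityʳ m) ⟨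
      (2 * m) ^ k           ≡⟨ ^-distrib-* k 2 m ⟩
      2 ^ k * m ^ k         ≤⟨ *-monoʳ-≤ (2 ^ k) hg ⟩
      2 ^ k * (c * g)       ∎

-- Counting in lists and among pairs.

module Counting where
  open import Data.Nat.Base using (_+_; _*_; _≤_; _<_)
  open import Data.Nat.Properties
  open import Data.Nat.Solver using (module +-*-Solver)

  length-filter-¬ : ∀ {A : Set} {P : A → Set} (P? : Decidable P) xs →
    length (filter P? xs) + length (filter (¬? ∘ P?) xs) ≡ length xs
  length-filter-¬ P? []       = ≡.refl
  length-filter-¬ P? (x ∷ xs) with ih ← length-filter-¬ P? xs | P? x
  ... | yes _ = cong suc ih
  ... | no  _ = ≡.trans (+-suc _ _) (cong suc ih)

  AllPairs-resp-⊆ : ∀ {A : Set} {R : A → A → Set} {xs ys} → xs ⊆ ys → AllPairs R ys → AllPairs R xs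
  AllPairs-resp-⊆ []            []       = []
  AllPairs-resp-⊆ (y ∷ʳ r)      (_ ∷ ps) = AllPairs-resp-⊆ r ps
  AllPairs-resp-⊆ (≡.refl ∷ r)  (p ∷ ps) = All-resp-⊆ r p ∷ AllPairs-resp-⊆ r ps

  AllPairs-resp-↭ : ∀ {A : Set} {R : A → A → Set} {xs ys} → Symmetric R →
    xs ↭ ys → AllPairs R xs → AllPairs R ys
  AllPairs-resp-↭ R-sym p = ↭ₛ.AllPairs-resp-↭ R-sym (≡.resp₂ _) (↭.↭⇒↭ₛ p)
    where module ↭ₛ = PermutationSetoid (≡.setoid _)

  lookup-injective : ∀ {A : Set} {_~_ : A → A → Set} → Symmetric _~_ → ∀ {xs} →
    AllPairs (λ x y → ¬ x ~ y) xs → ∀ i j → List.lookup xs i ~ List.lookup xs j → i ≡ j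
  lookup-injective ~-sym (d ∷ ds) zero    zero    _ = ≡.refl
  lookup-injective ~-sym {x ∷ xs} (d ∷ ds) zero    (suc j) e = contradiction e (All.lookup d (∈-lookup j))
  lookup-injective ~-sym {x ∷ xs} (d ∷ ds) (suc i) zero    e = contradiction (~-sym e) (All.lookup d (∈-lookup i))
  lookup-injective ~-sym (d ∷ ds) (suc i) (suc j) e = cong suc (lookup-injective ~-sym ds i j e)

  module _ {X Y : Set} where

    length-filter-disjoint : {P Q : Y → Set} (P? : Decidable P) (Q? : Decidable Q) →
      (∀ {y} → P y → ¬ Q y) → ∀ ys →
      length (filter Q? ys) ≤ length (filter Q? (filter (¬? ∘ P?) ys))
    length-filter-disjoint P? Q? disjoint []       = z≤n
    length-filter-disjoint P? Q? disjoint (y ∷ ys) with ih ← length-filter-disjoint P? Q? disjoint ys | P? y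
    ... | yes p with Q? y
    ...   | yes q = contradiction q (disjoint p)
    ...   | no  _ = ih
    length-filter-disjoint P? Q? disjoint (y ∷ ys) | no _ with Q? y
    ...   | yes _ = s≤s ih
    ...   | no  _ = ih

    -- The `ys` related to the first `x` are removed before the next one is treated; disjointness
    -- ensures that no later count drops.
    double-count : {R : X → Y → Set} (R? : ∀ x → Decidable (R x)) → ∀ k xs →
      AllPairs (λ x x′ → ∀ y → R x y → ¬ R x′ y) xs →
      ∀ ys → All (λ x → k ≤ 2 * length (filter (R? x) ys)) xs →
      length xs * k ≤ 2 * length ys
    double-count R? k []       []       ys []       = z≤n
    double-count R? k (x ∷ xs) (d ∷ ds) ys (h ∷ hs) = begin
      k + length xs * k                                               ≤⟨ +-mono-≤ h (double-count R? k xs ds others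
        (All.zipWith (λ {x′} (d , h) → ≤-trans h (*-monoʳ-≤ 2 (length-filter-disjoint (R? x) (R? x′) (d _) ys))) (d , hs))) ⟩
      2 * length (filter (R? x) ys) + 2 * length others               ≡⟨ *-distribˡ-+ 2 (length (filter (R? x) ys)) (length others) ⟨
      2 * (length (filter (R? x) ys) + length others)                 ≡⟨ cong (2 *_) (length-filter-¬ (R? x) ys) ⟩
      2 * length ys                                                   ∎
      where
      open ≤-Reasoning
      others = filter (¬? ∘ R? x) ys

  module _ {X : Set} where

    pairs : List X → List (X × X)
    pairs []       = []
    pairs (x ∷ xs) = map (x ,_) xs ++ pairs xs

    -- The count `n * (n - 1) / 2` of unordered pairs, freed of division and subtraction.
    length-pairs : ∀ xs → 2 * length (pairs xs) + length xs ≡ length xs * length xs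
    length-pairs []       = ≡.refl
    length-pairs (x ∷ xs) rewrite length-++ (map (x ,_) xs) {pairs xs} | length-map (x ,_) xs = begin
      2 * (n + p) + suc n           ≡⟨ solve 2 (λ n p → con 2 :* (n :+ p) :+ (con 1 :+ n) := (con 1 :+ n :+ n) :+ (con 2 :* p :+ n)) ≡.refl n p ⟩
      (suc n + n) + (2 * p + n)     ≡⟨ cong (λ x → suc n + n + x) (length-pairs xs) ⟩
      (suc n + n) + n * n           ≡⟨ solve 1 (λ n → (con 1 :+ n :+ n) :+ n :* n := (con 1 :+ n) :* (con 1 :+ n)) ≡.refl n ⟩
      suc n * suc n                 ∎
      where
      open ≡.≡-Reasoning
      open +-*-Solver
      n = length xs
      p = length (pairs xs)

    pairs-⊆ : ∀ {xs ys} → xs ⊆ ys → pairs xs ⊆ pairs ys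
    pairs-⊆ []                   = []
    pairs-⊆ (y ∷ʳ r)             = Sublist.++⁺ˡ (map (y ,_) _) (pairs-⊆ r)
    pairs-⊆ (_∷_ {x} ≡.refl r)   = Sublist.++⁺ (Sublist.map⁺ (x ,_) r) (pairs-⊆ r)

    -- A pair is related to at most one member, so the average number of pairs
    -- related to a member is below half the number of members.
    sparse : {R : X → X × X → Set} (R? : ∀ x → Decidable (R x)) → ∀ x xs →
      AllPairs (λ x x′ → ∀ y → R x y → ¬ R x′ y) (x ∷ xs) →
      ∃[ v ] (v ∈ x ∷ xs × 2 * length (filter (R? v) (pairs (x ∷ xs))) < length (x ∷ xs))
    sparse R? x xs disjoint with any? (λ v → 2 * length (filter (R? v) (pairs (x ∷ xs))) <? length (x ∷ xs)) (x ∷ xs)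
    ... | yes some = find some
    ... | no  none = contradiction n*n+n≤n*n (<⇒≱ (m<m+n (n * n) (s≤s z≤n)))
      where
      n = length (x ∷ xs)
      n*n+n≤n*n : n * n + n ≤ n * n
      n*n+n≤n*n = subst (n * n + n ≤_) (length-pairs (x ∷ xs))
        (+-monoˡ-≤ n (double-count R? n (x ∷ xs) disjoint (pairs (x ∷ xs)) (All.map ≮⇒≥ (All.¬Any⇒All¬ (x ∷ xs) none))))

    -- Dropping every element that is related to a later one costs at most one
    -- element per related pair.
    thin : {R : X × X → Set} (R? : Decidable R) → ∀ xs →
      ∃[ ys ] (ys ⊆ xs × AllPairs (λ x y → ¬ R (x , y)) ys ×
        length xs ≤ length ys + length (filter R? (pairs xs)))
    thin R? []       = [] , [] , [] , z≤n
    thin {R} R? (x ∷ xs) with ys , ys⊆ , unrelated , le ← thin R? xs | any? (λ y → R? (x , y)) xs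
    ... | no  none  = x ∷ ys , ≡.refl ∷ ys⊆ , All-resp-⊆ ys⊆ (All.¬Any⇒All¬ xs none) ∷ unrelated
        , s≤s (≤-trans le (+-monoʳ-≤ (length ys) (Sublist.length-mono-≤ (Sublist.filter⁺ R? R? (λ { ≡.refl r → r }) (Sublist.++⁺ˡ (map (x ,_) xs) Sublist.⊆-refl)))))
    ... | yes some  = ys , x ∷ʳ ys⊆ , unrelated , (begin
      suc (length xs)                                              ≤⟨ s≤s le ⟩
      suc (length ys + r)                                          ≡⟨ +-suc (length ys) r ⟨
      length ys + suc r                                            ≤⟨ +-monoʳ-≤ (length ys) (+-monoˡ-≤ r (filter-some R? (Any.map⁺ some))) ⟩
      length ys + (length (filter R? (map (x ,_) xs)) + r)         ≡⟨ cong (length ys +_) (length-++ (filter R? (map (x ,_) xs))) ⟨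
      length ys + length (filter R? (map (x ,_) xs) ++ filter R? (pairs xs)) ≡⟨ cong (λ zs → length ys + length zs) (filter-++ R? (map (x ,_) xs) (pairs xs)) ⟨
      length ys + length (filter R? (pairs (x ∷ xs)))              ∎)
      where
      open ≤-Reasoning
      r = length (filter R? (pairs xs))

-- Subset sums in abelian groups.

AbGroup : Set₁
AbGroup = AbelianGroup 0ℓ 0ℓ

-- For the step `v` of a chain `s`, `s + v`, `s + 2v`, ... this makes the points distinct, so that
-- the chain leaves every finite set.
TorsionFree : (G : AbGroup) → AbelianGroup.Carrier G → Set
TorsionFree G x = ∀ n → suc n · x ≉ ε
  where
  open AbelianGroup G
  open Mult monoid using () renaming (_×_ to _·_)

module SubsetSums (G : AbGroup) where
  open AbelianGroup G
  open AbelianGroupProperties G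
  open CommutativeSemigroupProperties commutativeSemigroup using (xy∙z≈xz∙y)

  -- The subset is hidden in the choices: each element is skipped (`inj₁`) or subtracted from the
  -- target (`inj₂`). No index set has to be carried through permutations, sublists and
  -- homomorphisms.
  SumOf : List Carrier → Carrier → Set
  SumOf []      s = s ≈ ε
  SumOf (a ∷ A) s = SumOf A s ⊎ SumOf A (s - a)

  SumOf-resp : ∀ A {s t} → s ≈ t → SumOf A s → SumOf A t
  SumOf-resp []      s≈t p        = trans (sym s≈t) p
  SumOf-resp (a ∷ A) s≈t (inj₁ p) = inj₁ (SumOf-resp A s≈t p)
  SumOf-resp (a ∷ A) s≈t (inj₂ p) = inj₂ (SumOf-resp A (∙-congʳ s≈t) p)

  SumOf-↭ : ∀ {A B s} → A ↭ B → SumOf A s → SumOf B s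
  SumOf-↭ ↭.refl        p               = p
  SumOf-↭ (prep a r)    (inj₁ p)        = inj₁ (SumOf-↭ r p)
  SumOf-↭ (prep a r)    (inj₂ p)        = inj₂ (SumOf-↭ r p)
  SumOf-↭ (swap a b r)  (inj₁ (inj₁ p)) = inj₁ (inj₁ (SumOf-↭ r p))
  SumOf-↭ (swap a b r)  (inj₁ (inj₂ p)) = inj₂ (inj₁ (SumOf-↭ r p))
  SumOf-↭ (swap a b r)  (inj₂ (inj₁ p)) = inj₁ (inj₂ (SumOf-↭ r p))
  SumOf-↭ {s = s} (swap {ys = B} a b r) (inj₂ (inj₂ p)) =
    inj₂ (inj₂ (SumOf-resp B (xy∙z≈xz∙y s (a ⁻¹) (b ⁻¹)) (SumOf-↭ r p)))
  SumOf-↭ (↭.trans q r) p               = SumOf-↭ r (SumOf-↭ q p)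

  SumOf-⊆ : ∀ {A B s} → A ⊆ B → SumOf A s → SumOf B s
  SumOf-⊆ []            p        = p
  SumOf-⊆ (b ∷ʳ r)      p        = inj₁ (SumOf-⊆ r p)
  SumOf-⊆ (≡.refl ∷ r)  (inj₁ p) = inj₁ (SumOf-⊆ r p)
  SumOf-⊆ (≡.refl ∷ r)  (inj₂ p) = inj₂ (SumOf-⊆ r p)

  SumOf-ε : ∀ A → SumOf A ε
  SumOf-ε []      = refl
  SumOf-ε (a ∷ A) = inj₁ (SumOf-ε A)

  -- A witness for a lower bound: some distinct sums, not necessarily all of them.
  record SumList (A : List Carrier) : Set where
    field
      sums     : List Carrier
      distinct : AllPairs _≉_ sums
      areSums  : All (SumOf A) sums

    size : ℕ
    size = length sums

  open SumList public

  SumList-map : ∀ {A B} → (∀ {s} → SumOf A s → SumOf B s) → SumList A → SumList B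
  SumList-map f L = record
    { sums = sums L ; distinct = distinct L ; areSums = All.map f (areSums L) }

  trivial : ∀ A → SumList A
  trivial A = record { sums = ε ∷ [] ; distinct = [] ∷ [] ; areSums = SumOf-ε A ∷ [] }

-- Sums along a homomorphism and in its fibres.

record Homomorphism (G H : AbGroup) : Set where
  private
    module G = AbelianGroup G
    module H = AbelianGroup H
  field
    φ      : G.Carrier → H.Carrier
    φ-cong : ∀ {x y} → x G.≈ y → φ x H.≈ φ y
    φ-homo : ∀ x y → φ (x G.∙ y) H.≈ φ x H.∙ φ y

module SumsAlong {G H : AbGroup} (hom : Homomorphism G H) where
  open import Data.Nat.Base using (_+_; _≤_; _<_; _⊔_)
  open import Data.Nat.Properties

  open Homomorphism hom
  private
    module G = AbelianGroup G
    module H = AbelianGroup H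
    module SG = SubsetSums G
    module SH = SubsetSums H
    module PG = AbelianGroupProperties G
    module PH = AbelianGroupProperties H

  φ-ε : φ G.ε H.≈ H.ε
  φ-ε = PH.identityˡ-unique (φ G.ε) (φ G.ε)
    (H.trans (H.sym (φ-homo G.ε G.ε)) (φ-cong (G.identityˡ G.ε)))

  pullback : ∀ A {w} → SH.SumOf (map φ A) w → ∃[ s ] (SG.SumOf A s × φ s H.≈ w)
  pullback []      p        = G.ε , G.refl , H.trans φ-ε (H.sym p)
  pullback (a ∷ A) (inj₁ p) with s , q , e ← pullback A p = s , inj₁ q , e
  pullback (a ∷ A) {w} (inj₂ p) with s , q , e ← pullback A p =
      s G.∙ a
    , inj₂ (SG.SumOf-resp A (G.sym (PG.//-rightDividesʳ a s)) q)
    , H.trans (φ-homo s a) (H.trans (H.∙-congʳ e) (PH.//-rightDividesˡ (φ a) w))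

  -- Points over distinct values are distinct. The last component strengthens the induction: it lets
  -- a new head be compared with the preimages already chosen for the tail.
  preimages : ∀ {Q : G.Carrier → Set} {W} →
    All (λ w → ∃[ u ] (Q u × φ u H.≈ w)) W → AllPairs H._≉_ W →
    ∃[ U ] (All Q U × AllPairs G._≉_ U × length U ≡ length W ×
      (∀ {x} → All (x H.≉_) W → All (λ u → x H.≉ φ u) U))
  preimages []                  []       = [] , [] , [] , ≡.refl , λ { [] → [] }
  preimages ((u , q , e) ∷ pre) (d ∷ ds) with U , qs , ds′ , len , tr ← preimages pre ds =
      u ∷ U
    , q ∷ qs
    , All.map (λ w≉ u≈ → w≉ (H.trans (H.sym e) (φ-cong u≈))) (tr d) ∷ ds′
    , cong suc len
    , λ { (x≉w ∷ x≉) → (λ x≈ → x≉w (H.trans x≈ e)) ∷ tr x≉ }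

  abstract
    -- A homomorphism cannot increase the number of sums: one preimage is chosen for every listed
    -- sum of the image.
    lift : ∀ {A} (L : SH.SumList (map φ A)) → Σ[ M ∈ SG.SumList A ] SG.size M ≡ SH.size L
    lift {A} L with U , qs , ds , len , _ ← preimages (All.map (pullback A) (SH.areSums L)) (SH.distinct L) =
      record { sums = U ; distinct = ds ; areSums = qs } , len

  module Kernel
    (em : ExcludedMiddle 0ℓ)
    (v : G.Carrier)
    (φv≈ε : φ v H.≈ H.ε)
    (torsionFree : TorsionFree G v)
    where

    open Mult G.monoid using (×-homo-+) renaming (_×_ to _·_)

    -- For the empty list the chain meets `ε` at most once by torsion-freeness, and excluded middle
    -- tells whether it does. For `a ∷ A` the chains from `s` and from `s - a` both have to leave
    -- the sums of `A`.
    escape : ∀ A s → ∃[ N ] ∀ k → N ≤ k → ¬ SG.SumOf A (s G.∙ k · v)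
    escape [] s with em {∃[ k ] s G.∙ k · v G.≈ G.ε}
    ... | no  never   = 0 , λ k _ p → never (k , p)
    ... | yes (k , p) = suc k , λ l k<l q → later l k<l q
      where
      later : ∀ l → k < l → ¬ (s G.∙ l · v G.≈ G.ε)
      later l k<l q with o , ≡.refl ← m≤n⇒∃[o]m+o≡n k<l = torsionFree o $ begin
        suc o · v                      ≈⟨ G.identityˡ _ ⟨
        G.ε G.∙ suc o · v              ≈⟨ G.∙-congʳ p ⟨
        s G.∙ k · v G.∙ suc o · v      ≈⟨ G.assoc s _ _ ⟩
        s G.∙ (k · v G.∙ suc o · v)    ≈⟨ G.∙-congˡ (×-homo-+ v k (suc o)) ⟨
        s G.∙ (k + suc o) · v          ≡⟨ cong (λ i → s G.∙ i · v) (+-suc k o) ⟩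
        s G.∙ (suc k + o) · v          ≈⟨ q ⟩
        G.ε                            ∎
        where open import Relation.Binary.Reasoning.Setoid G.setoid
    escape (a ∷ A) s with M , p ← escape A s | N , q ← escape A (s G.- a) =
      M ⊔ N , λ k le → λ where
        (inj₁ r) → p k (m⊔n≤o⇒m≤o M N le) r
        (inj₂ r) → q k (m⊔n≤o⇒n≤o M N le)
          (SG.SumOf-resp A (xy∙z≈xz∙y s (k · v) (a G.⁻¹)) r)
      where open CommutativeSemigroupProperties G.commutativeSemigroup using (xy∙z≈xz∙y)

    -- Walk along the chain until adding `v` no longer gives a sum. The point `N` steps ahead is not
    -- a sum, which bounds the walk, and `φ` is constant along it because `φ v` vanishes.
    chainEnd : ∀ A N s → SG.SumOf A s → ¬ SG.SumOf A (s G.∙ N · v) →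
      ∃[ t ] (SG.SumOf A t × ¬ SG.SumOf A (t G.∙ v) × φ t H.≈ φ s)
    chainEnd A zero    s p ¬p = contradiction (SG.SumOf-resp A (G.sym (G.identityʳ s)) p) ¬p
    chainEnd A (suc N) s p ¬p with em {SG.SumOf A (s G.∙ v)}
    ... | no ¬q = s , p , ¬q , H.refl
    ... | yes q with t , r , ¬r , e ← chainEnd A N (s G.∙ v) q
                       (¬p ∘ SG.SumOf-resp A (G.assoc s v (N · v))) =
      t , r , ¬r , H.trans e (φ-∙v s)
      where
      φ-∙v : ∀ x → φ (x G.∙ v) H.≈ φ x
      φ-∙v x = H.trans (φ-homo x v) (H.trans (H.∙-congˡ φv≈ε) (H.identityʳ (φ x)))

    newSum : ∀ A {w} → SH.SumOf (map φ A) w →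
      ∃[ u ] ((SG.SumOf (v ∷ A) u × ¬ SG.SumOf A u) × φ u H.≈ w)
    newSum A {w} p
      with s , q , e ← pullback A p
      with N , esc ← escape A s
      with t , r , ¬r , e′ ← chainEnd A N s q (esc N ≤-refl) =
        t G.∙ v
      , (inj₂ (SG.SumOf-resp A (G.sym (PG.//-rightDividesʳ v t)) r) , ¬r)
      , H.trans (φ-homo t v) (H.trans (H.∙-cong (H.trans e′ e) φv≈ε) (H.identityʳ w))

    abstract
      -- Every fibre of φ over a sum of map φ A contains the end of a v-chain of
      -- sums of A, and v added to that end is a sum which v ∷ A has and A lacks.
      extend : ∀ {A} (L : SG.SumList A) (M : SH.SumList (map φ A)) →
        Σ[ L′ ∈ SG.SumList (v ∷ A) ] SG.size L′ ≡ SG.size L + SH.size M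
      extend {A} L M
        with U , qs , ds , len , _ ← preimages (All.map (newSum A) (SH.areSums M)) (SH.distinct M) =
          record
            { sums     = SG.sums L ++ U
            ; distinct = AllPairs.++⁺ (SG.distinct L) ds (All.map
                (λ {x} p → All.map (λ { (_ , ¬p) x≈u → ¬p (SG.SumOf-resp A x≈u p) }) qs)
                (SG.areSums L))
            ; areSums  = All.++⁺ (All.map inj₁ (SG.areSums L)) (All.map proj₁ qs)
            }
        , ≡.trans (length-++ (SG.sums L)) (cong (SG.size L +_) len)

-- Ordered abelian groups, with the order given by its cone of positive elements.

record PositiveCone (G : AbGroup) : Set₁ where
  open AbelianGroup G
  field
    Pos        : Carrier → Set
    Pos-resp   : ∀ {x y} → x ≈ y → Pos x → Pos y
    Pos-∙      : ∀ {x y} → Pos x → Pos y → Pos (x ∙ y)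
    Pos⇒≉ε     : ∀ {x} → Pos x → x ≉ ε
    Pos-total  : ∀ {x} → x ≉ ε → Pos x ⊎ Pos (x ⁻¹)

-- Reversing the order lets results on positive elements apply to negative ones.
opposite : ∀ {G} → PositiveCone G → PositiveCone G
opposite {G} C = record
  { Pos       = λ x → Pos (x ⁻¹)
  ; Pos-resp  = Pos-resp ∘ ⁻¹-cong
  ; Pos-∙     = λ {x} {y} p q → Pos-resp (⁻¹-∙-comm x y) (Pos-∙ p q)
  ; Pos⇒≉ε    = λ p x≈ε → Pos⇒≉ε p (trans (⁻¹-cong x≈ε) ε⁻¹≈ε)
  ; Pos-total = λ x≉ε → [ (λ p → inj₂ (Pos-resp (sym (⁻¹-involutive _)) p)) , inj₁ ]′ (Pos-total x≉ε)
  }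
  where
  open AbelianGroup G
  open AbelianGroupProperties G
  open PositiveCone C

module OrderedGroup {G : AbGroup} (cone : PositiveCone G) where
  open import Data.Nat.Base using (_*_; _≤_)
  open Arithmetic using (square-step)
  open AbelianGroup G
  open AbelianGroupProperties G
  open CommutativeSemigroupProperties commutativeSemigroup using (xy∙z≈xz∙y)
  open PositiveCone cone
  open SubsetSums G
  open import Relation.Binary.Reasoning.Setoid setoid

  _>_ : Carrier → Carrier → Set
  x > y = Pos (x - y)

  >-trans : ∀ {x y z} → x > y → y > z → x > z
  >-trans {x} {y} {z} p q = Pos-resp telescope (Pos-∙ p q)
    where
    telescope : (x - y) ∙ (y - z) ≈ x - z
    telescope = begin
      (x - y) ∙ (y - z)  ≈⟨ assoc (x - y) y (z ⁻¹) ⟨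
      (x - y) ∙ y - z    ≈⟨ ∙-congʳ (//-rightDividesˡ y x) ⟩
      x - z              ∎

  >-connex : ∀ {x y} → x ≉ y → x > y ⊎ y > x
  >-connex {x} {y} x≉y with Pos-total (x≉y ∘ x∙y⁻¹≈ε⇒x≈y x y)
  ... | inj₁ p = inj₁ p
  ... | inj₂ p = inj₂ (Pos-resp (⁻¹-anti-homo‿- x y) p)

  x-ε≈x : ∀ x → x - ε ≈ x
  x-ε≈x x = trans (∙-congˡ ε⁻¹≈ε) (identityʳ x)

  Pos⇒TorsionFree : ∀ {x} → Pos x → TorsionFree G x
  Pos⇒TorsionFree {x} p n = Pos⇒≉ε (multiple n)
    where
    open Mult monoid using () renaming (_×_ to _·_)
    multiple : ∀ n → Pos (suc n · x)
    multiple zero    = Pos-resp (sym (identityʳ x)) p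
    multiple (suc n) = Pos-∙ p (multiple n)

  insert : ∀ a B → All (a ≉_) B → AllPairs _>_ B → ∃[ C ] (a ∷ B ↭ C × AllPairs _>_ C)
  insert a []      []         []         = a ∷ [] , ↭.refl , [] ∷ []
  insert a (b ∷ B) (a≉b ∷ a≉) (b> ∷ B>) with >-connex a≉b
  ... | inj₁ a>b = a ∷ b ∷ B , ↭.refl , (a>b ∷ All.map (>-trans a>b) b>) ∷ b> ∷ B>
  ... | inj₂ b>a with C , p , C> ← insert a B a≉ B> =
    b ∷ C , ↭.trans (swap a b ↭.refl) (prep b p) , All-resp-↭ p (b>a ∷ b>) ∷ C>

  sort : ∀ A → AllPairs _≉_ A → ∃[ B ] (A ↭ B × AllPairs _>_ B)
  sort []      []        = [] , ↭.refl , []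
  sort (a ∷ A) (a≉ ∷ A≉)
    with B , p , B> ← sort A A≉
    with C , q , C> ← insert a B (All-resp-↭ p a≉) B> = C , ↭.trans (prep a p) q , C>

  total : List Carrier → Carrier
  total = foldr _∙_ ε

  -- Leaving out a positive element only lowers a sum, so the full sum is the largest.
  total-maximum : ∀ {A s} → All Pos A → SumOf A s → ¬ s > total A
  total-maximum {s = s} []       s≈ε      s>ε = Pos⇒≉ε (Pos-resp (x-ε≈x s) s>ε) s≈ε
  total-maximum {a ∷ A} {s} (p ∷ ps) (inj₁ q) s>T = total-maximum ps q (Pos-resp regroup (Pos-∙ s>T p))
    where
    regroup : (s - a ∙ total A) ∙ a ≈ s - total A
    regroup = begin
      (s - a ∙ total A) ∙ a           ≈⟨ ∙-congʳ (∙-congˡ (⁻¹-cong (comm a (total A)))) ⟩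
      (s - total A ∙ a) ∙ a           ≈⟨ ∙-congʳ (∙-congˡ (⁻¹-∙-comm (total A) a)) ⟨
      s ∙ (total A ⁻¹ ∙ a ⁻¹) ∙ a     ≈⟨ ∙-congʳ (assoc s (total A ⁻¹) (a ⁻¹)) ⟨
      (s - total A - a) ∙ a           ≈⟨ //-rightDividesˡ a (s - total A) ⟩
      s - total A                     ∎
  total-maximum {a ∷ A} {s} (p ∷ ps) (inj₂ q) s>T = total-maximum ps q (Pos-resp regroup s>T)
    where
    regroup : s - (a ∙ total A) ≈ s - a - total A
    regroup = trans (∙-congˡ (sym (⁻¹-∙-comm a (total A)))) (sym (assoc s (a ⁻¹) (total A ⁻¹)))

  SumOf-total : ∀ A → SumOf A (total A)
  SumOf-total []      = refl
  SumOf-total (a ∷ A) = inj₂ (SumOf-resp A (sym (xyx⁻¹≈y a (total A))) (SumOf-total A))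

  total-less : ∀ {A a} → a ∈ A → SumOf A (total A - a)
  total-less {a ∷ A} (here ≡.refl) = inj₁ (SumOf-resp A (sym (xyx⁻¹≈y a (total A))) (SumOf-total A))
  total-less {b ∷ A} {a} (there a∈A) = inj₂ (SumOf-resp A regroup (total-less a∈A))
    where
    regroup : total A - a ≈ b ∙ total A - a - b
    regroup = begin
      total A - a            ≈⟨ ∙-congʳ (xyx⁻¹≈y b (total A)) ⟨
      b ∙ total A - b - a    ≈⟨ xy∙z≈xz∙y (b ∙ total A) (b ⁻¹) (a ⁻¹) ⟩
      b ∙ total A - a - b    ∎

  -- A largest element v adds the sums T + v − a with a ∈ ε ∷ A, where T is the
  -- total of A: they exceed T, and T is the largest sum of A.
  positive-sums : ∀ A → AllPairs _>_ A → All Pos A →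
    Σ[ L ∈ SumList A ] length A ^ 2 ≤ 2 * size L
  positive-sums []      []        []       = trivial [] , z≤n
  positive-sums (v ∷ A) (v> ∷ A>) (p ∷ ps) with L , bound ← positive-sums A A> ps =
      record
        { sums     = sums L ++ map top (ε ∷ A)
        ; distinct = AllPairs.++⁺ (distinct L)
            (AllPairs.map⁺ (AllPairs.map (λ a≉b → a≉b ∘ top-injective) (All.map ε≉ ps ∷ AllPairs.map >⇒≉ A>)))
            (All.map (λ {s} q → All.map⁺ (All.map (λ v>a s≈ →
              total-maximum ps q (Pos-resp (trans (sym (top-total _)) (∙-congʳ (sym s≈))) v>a)) v>εA))
              (areSums L))
        ; areSums  = All.++⁺ (All.map inj₁ (areSums L))
            (All.map⁺ (All.tabulate (λ a∈ → inj₂ (SumOf-resp A (sym (top-v _)) (lower a∈)))))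
        }
    , count
    where
    T = total A
    top : Carrier → Carrier
    top a = T ∙ v - a
    v>εA : All (v >_) (ε ∷ A)
    v>εA = Pos-resp (sym (x-ε≈x v)) p ∷ v>
    ε≉ : ∀ {a} → Pos a → ε ≉ a
    ε≉ q ε≈a = Pos⇒≉ε q (sym ε≈a)
    >⇒≉ : ∀ {a b} → a > b → a ≉ b
    >⇒≉ q a≈b = Pos⇒≉ε q (x≈y⇒x∙y⁻¹≈ε a≈b)
    top-injective : ∀ {a b} → top a ≈ top b → a ≈ b
    top-injective e = ⁻¹-injective (∙-cancelˡ (T ∙ v) _ _ e)
    top-v : ∀ a → top a - v ≈ T - a
    top-v a = trans (xy∙z≈xz∙y (T ∙ v) (a ⁻¹) (v ⁻¹)) (∙-congʳ (//-rightDividesʳ v T))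
    top-total : ∀ a → top a - T ≈ v - a
    top-total a = trans (xy∙z≈xz∙y (T ∙ v) (a ⁻¹) (T ⁻¹)) (∙-congʳ (xyx⁻¹≈y T v))
    lower : ∀ {a} → a ∈ ε ∷ A → SumOf A (T - a)
    lower (here ≡.refl) = SumOf-resp A (sym (x-ε≈x T)) (SumOf-total A)
    lower (there a∈A)   = total-less a∈A
    count : suc (length A) ^ 2 ≤ 2 * length (sums L ++ map top (ε ∷ A))
    count rewrite length-++ (sums L) {map top (ε ∷ A)} | length-map top A =
      square-step (length A) (size L) bound

module _ (em : ExcludedMiddle 0ℓ) {G : AbGroup} (cone : PositiveCone G) where
  open import Data.Nat.Base using (_+_; _*_; _≤_)
  open import Data.Nat.Properties
  open Arithmetic
  open Counting
  open AbelianGroup G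
  open PositiveCone cone
  open SubsetSums G

  -- At least half of the elements have the same sign.
  nonzero-sums : ∀ A → All (_≉ ε) A → AllPairs _≉_ A →
    Σ[ L ∈ SumList A ] length A ^ 2 ≤ 8 * size L
  nonzero-sums A A≉ε A≉ =
    [ (λ n≤p → sameSign cone (filter-⊆ Pos? A) (All.all-filter Pos? A)
        (subst₂ _≤_ (length-filter-¬ Pos? A) (double (length positives)) (+-monoʳ-≤ (length positives) n≤p)))
    , (λ p≤n → sameSign (opposite cone) (filter-⊆ (¬? ∘ Pos?) A) negative
        (subst₂ _≤_ (length-filter-¬ Pos? A) (double (length negatives)) (+-monoˡ-≤ (length negatives) p≤n)))
    ]′ (≤-total (length negatives) (length positives))
    where
    Pos? : Decidable Pos
    Pos? _ = em
    positives = filter Pos? A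
    negatives = filter (¬? ∘ Pos?) A
    double : ∀ n → n + n ≡ 2 * n
    double n = cong (n +_) (≡.sym (+-identityʳ n))
    negative : All (λ x → Pos (x ⁻¹)) negatives
    negative = All.zipWith
      (λ (¬p , x≉ε) → [ (λ p → contradiction p ¬p) , (λ p → p) ]′ (Pos-total x≉ε))
      (All.all-filter (¬? ∘ Pos?) A , All-resp-⊆ (filter-⊆ (¬? ∘ Pos?) A) A≉ε)
    sameSign : ∀ (C : PositiveCone G) {B} → B ⊆ A → All (PositiveCone.Pos C) B →
      length A ≤ 2 * length B → Σ[ L ∈ SumList A ] length A ^ 2 ≤ 8 * size L
    sameSign C {B} B⊆A B-pos le
      with S , p , S> ← OrderedGroup.sort C B (AllPairs-resp-⊆ B⊆A A≉)
      with L , bound ← OrderedGroup.positive-sums C S S> (All-resp-↭ p B-pos) =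
        SumList-map (SumOf-⊆ B⊆A ∘ SumOf-↭ (↭.↭-sym p)) L
      , square-half {k = length S} 2 (size L) (subst (λ k → length A ≤ 2 * k) (↭-length p) le) bound

-- Adding up the gains of successive removals.

module Induction (G : AbGroup) where
  open import Data.Nat.Base using (_+_; _*_; _≤_)
  open import Data.Nat.Properties
  open Arithmetic
  open AbelianGroup G using (Carrier)
  open SubsetSums G

  -- One removal: `Q` is the hypothesis that has to survive it, `gain` is the number of sums found
  -- in the image one dimension lower, and `nonempty` supplies the condition `1 ≤ m` of `growth`.
  record Reduction (Q : List Carrier → Set) (k c : ℕ) (A : List Carrier) : Set where
    field
      v        : Carrier
      rest     : List Carrier
      v∷rest↭A : v ∷ rest ↭ A
      Q-rest   : Q rest
      nonempty : 1 ≤ length rest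
      gain     : ℕ
      bound    : length rest ^ k ≤ c * gain
      extend   : (L : SumList rest) → Σ[ L′ ∈ SumList (v ∷ rest) ] size L′ ≡ size L + gain

  -- The gains of the removals telescope by `growth`. The recursion is on the length, since `rest`
  -- is related to `A` only through a permutation.
  many-sums : ∀ {Q k c c₀} →
    (∀ A → Q A → length A ^ suc k ≤ c₀ ⊎ Reduction Q k c A) →
    ∀ A → Q A → Σ[ L ∈ SumList A ] length A ^ suc k ≤ growthConstant k c c₀ * size L
  many-sums {Q} {k} {c} {c₀} reduce A q = go (length A) A q ≡.refl
    where
    C = growthConstant k c c₀
    go : ∀ n A → Q A → length A ≡ n → Σ[ L ∈ SumList A ] length A ^ suc k ≤ C * size L
    go n A q len with reduce A q
    -- A single sum suffices here: the summand `c₀` of `C` already bounds the power.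
    ... | inj₁ small = trivial A
        , ≤-trans small (≤-trans (m≤n+m c₀ (suc k * (2 ^ k * c))) (≤-reflexive (≡.sym (*-identityʳ C))))
    ... | inj₂ r with n | ≡.trans (↭-length (Reduction.v∷rest↭A r)) len
    ... | suc n | ≡.refl with go n (Reduction.rest r) (Reduction.Q-rest r) ≡.refl
    ... | L , ih with Reduction.extend r L
    ... | L′ , size≡ =
          SumList-map (SumOf-↭ v∷rest↭A) L′
        , subst₂ (λ m s → m ^ suc k ≤ C * s) (↭-length v∷rest↭A) (≡.sym size≡)
            (growth k c c₀ (size L) gain nonempty ih bound)
      where open Reduction r

-- A ring solver with integer coefficients.

module IntegerSolver (K : CommutativeRing 0ℓ 0ℓ) where
  open import Data.Integer.Base using (+_)
  open import Data.Nat.Base using (_+_; _*_)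
  open CommutativeRing K renaming (_+_ to _⊞_; _*_ to _⊠_; -_ to ⊟_; _-_ to _−_)
  open AbelianGroupProperties +-abelianGroup
  open RingProperties ring using (-‿distribˡ-*; -‿distribʳ-*; -0#≈0#)
  open SemiringMult semiring using (×-homo-+; ×1-homo-*) renaming (_×_ to _·_)
  open import Relation.Binary.Reasoning.Setoid setoid

  -- The canonical homomorphism from the integers. Integer coefficients can be compared, so terms
  -- cancel without a decision procedure for `_≈_`.
  ⟦_⟧ : ℤ → Carrier
  ⟦ + n      ⟧ = n · 1#
  ⟦ -[1+ n ] ⟧ = ⊟ (suc n · 1#)

  ⟦-⟧ : ∀ i → ⟦ ℤ.- i ⟧ ≈ ⊟ ⟦ i ⟧
  ⟦-⟧ (+ zero)   = sym -0#≈0#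
  ⟦-⟧ (+ suc n)  = refl
  ⟦-⟧ -[1+ n ]   = sym (⁻¹-involutive _)

  ⟦⊖⟧ : ∀ m n → ⟦ m ⊖ n ⟧ ≈ m · 1# − n · 1#
  ⟦⊖⟧ m       zero    = sym (trans (+-congˡ -0#≈0#) (+-identityʳ _))
  ⟦⊖⟧ zero    (suc n) = sym (+-identityˡ _)
  ⟦⊖⟧ (suc m) (suc n) = begin
    ⟦ suc m ⊖ suc n ⟧                 ≡⟨ cong ⟦_⟧ (ℤ.[1+m]⊖[1+n]≡m⊖n m n) ⟩
    ⟦ m ⊖ n ⟧                         ≈⟨ ⟦⊖⟧ m n ⟩
    m · 1# − n · 1#                   ≈⟨ +-congʳ (xyx⁻¹≈y 1# _) ⟨
    1# ⊞ m · 1# − 1# − n · 1#         ≈⟨ +-assoc _ _ _ ⟩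
    1# ⊞ m · 1# ⊞ (⊟ 1# − n · 1#)     ≈⟨ +-congˡ (⁻¹-∙-comm 1# _) ⟩
    1# ⊞ m · 1# − (1# ⊞ n · 1#)       ∎

  ⟦+⟧ : ∀ i j → ⟦ i ℤ.+ j ⟧ ≈ ⟦ i ⟧ ⊞ ⟦ j ⟧
  ⟦+⟧ (+ m)    (+ n)    = ×-homo-+ 1# m n
  ⟦+⟧ (+ m)    -[1+ n ] = ⟦⊖⟧ m (suc n)
  ⟦+⟧ -[1+ m ] (+ n)    = trans (⟦⊖⟧ n (suc m)) (+-comm _ _)
  ⟦+⟧ -[1+ m ] -[1+ n ] = begin
    ⊟ (suc (suc (m + n)) · 1#)         ≡⟨ cong (λ k → ⊟ (suc k · 1#)) (ℕ.+-suc m n) ⟨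
    ⊟ ((suc m + suc n) · 1#)           ≈⟨ -‿cong (×-homo-+ 1# (suc m) (suc n)) ⟩
    ⊟ (suc m · 1# ⊞ suc n · 1#)        ≈⟨ ⁻¹-∙-comm _ _ ⟨
    ⊟ (suc m · 1#) ⊞ ⊟ (suc n · 1#)    ∎

  ⟦+*⟧ : ∀ m j → ⟦ + m ℤ.* j ⟧ ≈ ⟦ + m ⟧ ⊠ ⟦ j ⟧
  ⟦+*⟧ m (+ n) = begin
    ⟦ + m ℤ.* + n ⟧       ≡⟨ cong ⟦_⟧ (ℤ.pos-* m n) ⟨
    (m * n) · 1#          ≈⟨ ×1-homo-* m n ⟩
    m · 1# ⊠ n · 1#       ∎
  ⟦+*⟧ m -[1+ n ] = begin
    ⟦ + m ℤ.* -[1+ n ] ⟧       ≡⟨ cong ⟦_⟧ (ℤ.neg-distribʳ-* (+ m) (+ suc n)) ⟨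
    ⟦ ℤ.- (+ m ℤ.* + suc n) ⟧  ≈⟨ ⟦-⟧ (+ m ℤ.* + suc n) ⟩
    ⊟ ⟦ + m ℤ.* + suc n ⟧      ≈⟨ -‿cong (⟦+*⟧ m (+ suc n)) ⟩
    ⊟ (⟦ + m ⟧ ⊠ ⟦ + suc n ⟧)  ≈⟨ -‿distribʳ-* _ _ ⟩
    ⟦ + m ⟧ ⊠ ⟦ -[1+ n ] ⟧     ∎

  ⟦*⟧ : ∀ i j → ⟦ i ℤ.* j ⟧ ≈ ⟦ i ⟧ ⊠ ⟦ j ⟧
  ⟦*⟧ (+ m)    j = ⟦+*⟧ m j
  ⟦*⟧ -[1+ m ] j = begin
    ⟦ -[1+ m ] ℤ.* j ⟧         ≡⟨ cong ⟦_⟧ (ℤ.neg-distribˡ-* (+ suc m) j) ⟨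
    ⟦ ℤ.- (+ suc m ℤ.* j) ⟧    ≈⟨ ⟦-⟧ (+ suc m ℤ.* j) ⟩
    ⊟ ⟦ + suc m ℤ.* j ⟧        ≈⟨ -‿cong (⟦+*⟧ (suc m) j) ⟩
    ⊟ (⟦ + suc m ⟧ ⊠ ⟦ j ⟧)    ≈⟨ -‿distribˡ-* _ _ ⟩
    ⟦ -[1+ m ] ⟧ ⊠ ⟦ j ⟧       ∎

  almostCommutativeRing : ACR.AlmostCommutativeRing 0ℓ 0ℓ
  almostCommutativeRing = ACR.fromCommutativeRing K

  morphism : ℤ.+-*-rawRing ACR.-Raw-AlmostCommutative⟶ almostCommutativeRing
  morphism = record
    { ⟦_⟧ = ⟦_⟧ ; +-homo = ⟦+⟧ ; *-homo = ⟦*⟧ ; -‿homo = ⟦-⟧ ; 0-homo = refl ; 1-homo = +-identityʳ 1# }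

  coefficient≟ : ∀ i j → Maybe (⟦ i ⟧ ≈ ⟦ j ⟧)
  coefficient≟ i j = Maybe.map (λ { ≡.refl → refl }) (dec⇒maybe (i ℤ.≟ j))

  open RingSolver ℤ.+-*-rawRing almostCommutativeRing morphism coefficient≟
    public using (solve; _:+_; _:*_; _:-_; :-_; con; _:=_)

-- Linear algebra over an ordered ring.

record OrderedRing : Set₁ where
  field
    ring : CommutativeRing 0ℓ 0ℓ
    cone : PositiveCone (CommutativeRing.+-abelianGroup ring)
  open CommutativeRing ring
  open PositiveCone cone
  field
    Pos-* : ∀ {x y} → Pos x → Pos y → Pos (x * y)
    1≉0   : 1# ≉ 0#

module LinearAlgebra (em : ExcludedMiddle 0ℓ) (R : OrderedRing) where
  open import Data.Nat.Base using (_+_; _*_; _≤_; _<_)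
  open import Data.Nat.Properties

  open OrderedRing R
  open PositiveCone cone
  private module K = CommutativeRing ring
  open K using (_≈_; _≉_; 0#; 1#; -_) renaming (Carrier to F; _+_ to _⊞_; _*_ to _⊠_; _-_ to _−_)
  open AbelianGroupProperties K.+-abelianGroup using (x∙y⁻¹≈ε⇒x≈y; x≈y⇒x∙y⁻¹≈ε; ε⁻¹≈ε)
  open IntegerSolver ring
  open Arithmetic
  open Counting

  -- After changes of sign both factors are positive, and so is their product.
  ⊠-≉0 : ∀ {x y} → x ≉ 0# → y ≉ 0# → x ⊠ y ≉ 0#
  ⊠-≉0 {x} {y} x≉0 y≉0 xy≈0 with Pos-total x≉0 | Pos-total y≉0
  ... | inj₁ p | inj₁ q = Pos⇒≉ε (Pos-* p q) xy≈0
  ... | inj₁ p | inj₂ q = Pos⇒≉ε (Pos-* p q) (K.trans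
    (solve 2 (λ x y → x :* :- y := :- (x :* y)) K.refl x y) (K.trans (K.-‿cong xy≈0) ε⁻¹≈ε))
  ... | inj₂ p | inj₁ q = Pos⇒≉ε (Pos-* p q) (K.trans
    (solve 2 (λ x y → :- x :* y := :- (x :* y)) K.refl x y) (K.trans (K.-‿cong xy≈0) ε⁻¹≈ε))
  ... | inj₂ p | inj₂ q = Pos⇒≉ε (Pos-* p q) (K.trans
    (solve 2 (λ x y → :- x :* :- y := x :* y) K.refl x y) xy≈0)

  -- Takes the place of division: linear relations are multiplied through by a nonzero scalar, which
  -- is cancelled afterwards.
  cancelˡ : ∀ {x y} → x ≉ 0# → x ⊠ y ≈ 0# → y ≈ 0#
  cancelˡ x≉0 xy≈0 = decidable-stable em λ y≉0 → ⊠-≉0 x≉0 y≉0 xy≈0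

  torsionFree : ∀ {x} → x ≉ 0# → TorsionFree K.+-abelianGroup x
  torsionFree x≉0 = [ OrderedGroup.Pos⇒TorsionFree cone , negative ]′ (Pos-total x≉0)
    where
    negative : ∀ {x} → Pos (- x) → TorsionFree K.+-abelianGroup x
    negative = OrderedGroup.Pos⇒TorsionFree (opposite cone)

  space : ℕ → AbGroup
  space n = Pointwise.abelianGroup (Fin n) K.+-abelianGroup

  Vec : ℕ → Set
  Vec n = Fin n → F

  module V {n} = AbelianGroup (space n)
  open module S {n} = SubsetSums (space n) using (SumList; size)
  open V using () renaming (_≈_ to _≈ᵥ_; _≉_ to _≉ᵥ_; _∙_ to _+ᵥ_; _-_ to _-ᵥ_; ε to 0ᵥ)

  infixr 8 _*ᵥ_
  _*ᵥ_ : ∀ {n} → F → Vec n → Vec n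
  (c *ᵥ x) i = c ⊠ x i

  nonzeroCoordinate : ∀ {n} {v : Vec n} → v ≉ᵥ 0ᵥ → ∃[ i ] v i ≉ 0#
  nonzeroCoordinate v≉0 = decidable-stable em λ none →
    v≉0 λ i → decidable-stable em λ vi≉0 → none (i , vi≉0)

  torsionFreeᵥ : ∀ {n} {v : Vec n} i → v i ≉ 0# → TorsionFree (space n) v
  torsionFreeᵥ {n} {v} i vi≉0 m mv≈0 =
    torsionFree vi≉0 m (K.trans (K.sym (coordinate (suc m))) (mv≈0 i))
    where
    open Mult (V.monoid {n}) using () renaming (_×_ to _·ᵥ_)
    open Mult K.+-monoid using () renaming (_×_ to _·_)
    coordinate : ∀ k → (k ·ᵥ v) i ≈ k · v i
    coordinate zero    = K.refl
    coordinate (suc k) = K.+-congˡ (coordinate k)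

  -- Combination b k A w: exactly k positions of A enter, with coefficients that may
  -- vanish; b = true certifies that one of them does not.
  data Combination {n} : Bool → ℕ → List (Vec n) → Vec n → Set where
    []   : ∀ {w} → w ≈ᵥ 0ᵥ → Combination false 0 [] w
    skip : ∀ {b k a A w} → Combination b k A w → Combination b k (a ∷ A) w
    use  : ∀ {b k a A w} c → Combination b k A (w -ᵥ c *ᵥ a) → Combination b (suc k) (a ∷ A) w
    use≉ : ∀ {b k a A w} c → c ≉ 0# → Combination b k A (w -ᵥ c *ᵥ a) →
           Combination true (suc k) (a ∷ A) w

  Independent : (n : ℕ) → List (Vec n) → Set
  Independent n A = ∀ {w} → w ≈ᵥ 0ᵥ → ¬ Combination true n A w

  Combination-resp : ∀ {n b k} {A : List (Vec n)} {w x} → w ≈ᵥ x → Combination b k A w → Combination b k A x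
  Combination-resp w≈x ([] w≈0)     = [] (V.trans (V.sym w≈x) w≈0)
  Combination-resp w≈x (skip p)     = skip (Combination-resp w≈x p)
  Combination-resp w≈x (use c p)    = use c (Combination-resp (V.∙-congʳ w≈x) p)
  Combination-resp w≈x (use≉ c d p) = use≉ c d (Combination-resp (V.∙-congʳ w≈x) p)

  0-multiple : ∀ {n} (w a : Vec n) → w ≈ᵥ w -ᵥ 0# *ᵥ a
  0-multiple w a i = solve 2 (λ w a → w := w :- con 0ℤ :* a) K.refl (w i) (a i)

  -- Padding with vanishing coefficients, which turns a relation among fewer vectors into one on
  -- exactly the required number of positions.
  zeroCombination : ∀ {n} k (A : List (Vec n)) → k ≤ length A → Combination false k A 0ᵥ
  zeroCombination zero    []      _        = [] V.refl
  zeroCombination zero    (a ∷ A) _        = skip (zeroCombination zero A z≤n)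
  zeroCombination (suc k) (a ∷ A) (s≤s le) =
    use 0# (Combination-resp (0-multiple 0ᵥ a) (zeroCombination k A le))

  singleton : ∀ {n} {a : Vec n} {A} → a ∈ A → ∀ c → Combination false 1 A (c *ᵥ a)
  singleton {a = a} {A = _ ∷ A} (here ≡.refl) c =
    use c (Combination-resp (λ i → K.sym (K.-‿inverseʳ (c ⊠ a i))) (zeroCombination 0 A z≤n))
  singleton (there a∈A) c = skip (singleton a∈A c)

  singleton≉ : ∀ {n} {a : Vec n} {A} → a ∈ A → ∀ {c} → c ≉ 0# → Combination true 1 A (c *ᵥ a)
  singleton≉ {a = a} {A = _ ∷ A} (here ≡.refl) {c} c≉0 =
    use≉ c c≉0 (Combination-resp (λ i → K.sym (K.-‿inverseʳ (c ⊠ a i))) (zeroCombination 0 A z≤n))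
  singleton≉ (there a∈A) c≉0 = skip (singleton≉ a∈A c≉0)

  scale : ∀ {n b k c} {A : List (Vec n)} {w} → c ≉ 0# → Combination b k A w → Combination b k A (c *ᵥ w)
  scale {c = c} c≉0 ([] w≈0) = [] (λ i → K.trans (K.*-congˡ (w≈0 i)) (K.zeroʳ c))
  scale c≉0 (skip p) = skip (scale c≉0 p)
  scale {c = c} {a ∷ _} {w} c≉0 (use e p) = use (c ⊠ e) (Combination-resp
    (λ i → solve 4 (λ c w e a → c :* (w :- e :* a) := c :* w :- c :* e :* a) K.refl c (w i) e (a i)) (scale c≉0 p))
  scale {c = c} {a ∷ _} {w} c≉0 (use≉ e e≉0 p) = use≉ (c ⊠ e) (⊠-≉0 c≉0 e≉0) (Combination-resp
    (λ i → solve 4 (λ c w e a → c :* (w :- e :* a) := c :* w :- c :* e :* a) K.refl c (w i) e (a i)) (scale c≉0 p))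

  Independent-tail : ∀ {n a} {A : List (Vec n)} → Independent n (a ∷ A) → Independent n A
  Independent-tail ind w≈0 = ind w≈0 ∘ skip

  -- Dimension one.

  module Line where
    ≉0 : ∀ {A} → Independent 1 A → All (λ a → a zero ≉ 0#) A
    ≉0 ind = All.tabulate λ {a} a∈A a₀≈0 →
      ind (λ { zero → K.trans (K.*-congˡ a₀≈0) (K.zeroʳ 1#) }) (singleton≉ a∈A 1≉0)

    many-sums : ∀ A → AllPairs _≉ᵥ_ A → Independent 1 A →
      Σ[ L ∈ SumList A ] length A ^ 2 ≤ 8 * size L
    many-sums A A≉ ind = proj₁ lifted
      , subst₂ (λ m s → m ^ 2 ≤ 8 * s) (length-map _ A) (≡.sym (proj₂ lifted)) (proj₂ values)
      where
      values = nonzero-sums em cone (map (λ a → a zero) A) (All.map⁺ (≉0 ind))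
        (AllPairs.map⁺ (AllPairs.map (λ a≉b a₀≈b₀ → a≉b λ { zero → a₀≈b₀ }) A≉))
      coordinate : Homomorphism (space 1) K.+-abelianGroup
      coordinate = record { φ = λ a → a zero ; φ-cong = λ a≈b → a≈b zero ; φ-homo = λ _ _ → K.refl }
      lifted = SumsAlong.lift coordinate (proj₁ values)

  -- Dimension two.

  module Plane where
    x₀ x₁ : Vec 2 → F
    x₀ a = a zero
    x₁ a = a (suc zero)

    -- With `v` fixed, `det v` serves as the projection along `v` to the line: it is linear and
    -- vanishes at `v`.
    det : Vec 2 → Vec 2 → F
    det a b = x₀ a ⊠ x₁ b − x₁ a ⊠ x₀ b

    Skew : Vec 2 → Vec 2 → Set
    Skew a b = det a b ≉ 0#

    det-cong : ∀ v {a b} → a ≈ᵥ b → det v a ≈ det v b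
    det-cong v a≈b = K.+-cong (K.*-congˡ (a≈b (suc zero))) (K.-‿cong (K.*-congˡ (a≈b zero)))

    det-+ : ∀ v a b → det v (a +ᵥ b) ≈ det v a ⊞ det v b
    det-+ v a b = solve 6 (λ v₀ v₁ a₀ a₁ b₀ b₁ →
      v₀ :* (a₁ :+ b₁) :- v₁ :* (a₀ :+ b₀) := (v₀ :* a₁ :- v₁ :* a₀) :+ (v₀ :* b₁ :- v₁ :* b₀))
      K.refl (x₀ v) (x₁ v) (x₀ a) (x₁ a) (x₀ b) (x₁ b)

    det-homomorphism : Vec 2 → Homomorphism (space 2) K.+-abelianGroup
    det-homomorphism v = record { φ = det v ; φ-cong = det-cong v ; φ-homo = det-+ v }

    det-self : ∀ v → det v v ≈ 0#
    det-self v = solve 2 (λ v₀ v₁ → v₀ :* v₁ :- v₁ :* v₀ := con 0ℤ) K.refl (x₀ v) (x₁ v)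

    Skew-sym : ∀ {a b} → Skew a b → Skew b a
    Skew-sym {a} {b} ab≉0 ba≈0 = ab≉0 (K.trans
      (solve 4 (λ a₀ a₁ b₀ b₁ → a₀ :* b₁ :- a₁ :* b₀ := :- (b₀ :* a₁ :- b₁ :* a₀)) K.refl (x₀ a) (x₁ a) (x₀ b) (x₁ b))
      (K.trans (K.-‿cong ba≈0) ε⁻¹≈ε))

    det-0ˡ : ∀ {v} b → v ≈ᵥ 0ᵥ → det v b ≈ 0#
    det-0ˡ {v} b v≈0 = K.trans
      (K.+-cong (K.*-congʳ (v≈0 zero)) (K.-‿cong (K.*-congʳ (v≈0 (suc zero)))))
      (solve 2 (λ b₀ b₁ → con 0ℤ :* b₁ :- con 0ℤ :* b₀ := con 0ℤ) K.refl (x₀ b) (x₁ b))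

    -- Cramer's rule for `x` in terms of `v` and `w`, multiplied through by `det v w`.
    plücker : ∀ v w x i → det v w ⊠ x i ≈ w i ⊠ det v x − v i ⊠ det w x
    plücker v w x zero = solve 6 (λ v₀ v₁ w₀ w₁ x₀ x₁ →
      (v₀ :* w₁ :- v₁ :* w₀) :* x₀ :=
      w₀ :* (v₀ :* x₁ :- v₁ :* x₀) :- v₀ :* (w₀ :* x₁ :- w₁ :* x₀))
      K.refl (x₀ v) (x₁ v) (x₀ w) (x₁ w) (x₀ x) (x₁ x)
    plücker v w x (suc zero) = solve 6 (λ v₀ v₁ w₀ w₁ x₀ x₁ →
      (v₀ :* w₁ :- v₁ :* w₀) :* x₁ :=
      w₁ :* (v₀ :* x₁ :- v₁ :* x₀) :- v₁ :* (w₀ :* x₁ :- w₁ :* x₀))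
      K.refl (x₀ v) (x₁ v) (x₀ w) (x₁ w) (x₀ x) (x₁ x)

    doublyParallel : ∀ {v w x} → Skew v w → det v x ≈ 0# → det w x ≈ 0# → x ≈ᵥ 0ᵥ
    doublyParallel {v} {w} {x} skew e e′ i = cancelˡ skew (K.trans (plücker v w x i) (K.trans
      (K.+-cong (K.*-congˡ e) (K.-‿cong (K.*-congˡ e′)))
      (solve 2 (λ p q → p :* con 0ℤ :- q :* con 0ℤ := con 0ℤ) K.refl (w i) (v i))))

    det-difference : ∀ v a b → det v a ≈ det v b → det v (a -ᵥ b) ≈ 0#
    det-difference v a b e = K.trans
      (solve 6 (λ v₀ v₁ a₀ a₁ b₀ b₁ →
        v₀ :* (a₁ :- b₁) :- v₁ :* (a₀ :- b₀) := (v₀ :* a₁ :- v₁ :* a₀) :- (v₀ :* b₁ :- v₁ :* b₀))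
        K.refl (x₀ v) (x₁ v) (x₀ a) (x₁ a) (x₀ b) (x₁ b))
      (x≈y⇒x∙y⁻¹≈ε e)

    -- The clause `a ≉ᵥ b` makes `collide-disjoint` true for arbitrary pairs; for skew pairs
    -- `Skew⇒≉` provides it.
    Collide : Vec 2 → Vec 2 × Vec 2 → Set
    Collide v (a , b) = a ≉ᵥ b × det v a ≈ det v b

    -- A common collision makes `a - b` parallel to both `v` and `w`, hence zero.
    collide-disjoint : ∀ {v w} → Skew v w → ∀ ab → Collide v ab → ¬ Collide w ab
    collide-disjoint {v} {w} skew (a , b) (a≉b , e) (_ , e′) =
      a≉b (AbelianGroupProperties.x∙y⁻¹≈ε⇒x≈y (space 2) a b
        (doublyParallel {v} {w} skew (det-difference v a b e) (det-difference w a b e′)))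

    Skew⇒≉ : ∀ {a b} → Skew a b → a ≉ᵥ b
    Skew⇒≉ {a} ab≉0 a≈b = ab≉0 (K.trans (det-cong a (V.sym a≈b)) (det-self a))

    Skew⇒nonzeroCoordinate : ∀ {v A} → 1 ≤ length A → All (Skew v) A → ∃[ i ] v i ≉ 0#
    Skew⇒nonzeroCoordinate {v} {a ∷ _} _ (va≉0 ∷ _) = nonzeroCoordinate (va≉0 ∘ det-0ˡ {v} a)

    open Induction (space 2)

    -- Few collisions in the direction v leave at least half as many values det v a
    -- as there are members a, and d = 1 applies to these.
    sparse⇒Reduction : ∀ {A v rest} → v ∷ rest ↭ A → rest ⊆ A → 1 ≤ length rest → AllPairs Skew A →
      2 * length (filter (λ _ → em {Collide v _}) (pairs A)) < length A → Reduction (AllPairs Skew) 2 32 A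
    sparse⇒Reduction {A} {v} {rest} perm rest⊆A nonempty skew few = record
      { v        = v
      ; rest     = rest
      ; v∷rest↭A = perm
      ; Q-rest   = AllPairs.tail skew′
      ; nonempty = nonempty
      ; gain     = SubsetSums.size L
      ; bound    = square-half {k = length (map (det v) D)} 8 (SubsetSums.size L) manyValues (proj₂ values)
      ; extend   = λ M → Kernel.extend M
          (SubsetSums.SumList-map K.+-abelianGroup (SubsetSums.SumOf-⊆ K.+-abelianGroup (Sublist.map⁺ (det v) D⊆rest)) L)
      }
      where
      skew′ : AllPairs Skew (v ∷ rest)
      skew′ = AllPairs-resp-↭ (λ {a} {b} → Skew-sym {a} {b}) (↭.↭-sym perm) skew
      collide? : Decidable (Collide v)
      collide? _ = em
      thinned = thin collide? rest
      D = proj₁ thinned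
      D⊆rest = proj₁ (proj₂ thinned)
      values : Σ[ L ∈ SubsetSums.SumList K.+-abelianGroup (map (det v) D) ]
        length (map (det v) D) ^ 2 ≤ 8 * SubsetSums.size L
      values = nonzero-sums em cone (map (det v) D)
        (All.map⁺ (All-resp-⊆ D⊆rest (AllPairs.head skew′)))
        (AllPairs.map⁺ (AllPairs.zipWith (λ (ab , ¬collide) e → ¬collide (Skew⇒≉ ab , e))
          (AllPairs-resp-⊆ D⊆rest (AllPairs.tail skew′) , proj₁ (proj₂ (proj₂ thinned)))))
      L = proj₁ values
      v≉0 = Skew⇒nonzeroCoordinate {v} nonempty (AllPairs.head skew′)
      module Kernel = SumsAlong.Kernel (det-homomorphism v)
        em v (det-self v) (torsionFreeᵥ (proj₁ v≉0) (proj₂ v≉0))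
      -- The bound `few` is strict and `A` is longer than `rest` by one, so twice the number of
      -- collisions is at most `length rest`. Doubling the estimate from `thin` and cancelling one
      -- `length rest` gives the claim.
      manyValues : length rest ≤ 2 * length (map (det v) D)
      manyValues = +-cancelʳ-≤ (length rest) _ _ (begin
        length rest + length rest                        ≡⟨ cong (length rest +_) (+-identityʳ _) ⟨
        2 * length rest                                  ≤⟨ *-monoʳ-≤ 2 (proj₂ (proj₂ (proj₂ thinned))) ⟩
        2 * (length D + length (filter collide? (pairs rest)))
          ≡⟨ *-distribˡ-+ 2 (length D) _ ⟩
        2 * length D + 2 * length (filter collide? (pairs rest))
          ≤⟨ +-monoʳ-≤ (2 * length D) (≤-trans
               (*-monoʳ-≤ 2 (Sublist.length-mono-≤ (Sublist.filter⁺ collide? collide? (λ { ≡.refl r → r }) (pairs-⊆ rest⊆A))))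
               (≤-pred (≤-trans few (≤-reflexive (≡.sym (↭-length perm)))))) ⟩
        2 * length D + length rest                       ≡⟨ cong (λ n → 2 * n + length rest) (length-map (det v) D) ⟨
        2 * length (map (det v) D) + length rest         ∎)
        where open ≤-Reasoning

    reduction : ∀ A → AllPairs Skew A → length A ^ 3 ≤ 1 ⊎ Reduction (AllPairs Skew) 2 32 A
    reduction []          _    = inj₁ z≤n
    reduction (_ ∷ [])    _    = inj₁ ≤-refl
    reduction (a ∷ b ∷ A) skew = inj₂ (choose (sparse (λ _ _ → em) a (b ∷ A) (AllPairs.map (λ {v} {w} → collide-disjoint {v} {w}) skew)))
      where
      choose : ∃[ v ] (v ∈ a ∷ b ∷ A ×
        2 * length (filter (λ _ → em {Collide v _}) (pairs (a ∷ b ∷ A))) < length (a ∷ b ∷ A)) →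
        Reduction (AllPairs Skew) 2 32 (a ∷ b ∷ A)
      choose (v , v∈ , few) = split (∈-∃++ v∈)
        where
        split : ∃[ xs ] ∃[ ys ] a ∷ b ∷ A ≡ xs ++ v ∷ ys → Reduction (AllPairs Skew) 2 32 (a ∷ b ∷ A)
        split (xs , ys , eq) = sparse⇒Reduction perm
          (subst (xs ++ ys ⊆_) (≡.sym eq) (Sublist.++⁺ (Sublist.⊆-refl {x = xs}) (v ∷ʳ Sublist.⊆-refl)))
          (≤-trans (s≤s z≤n) (≤-reflexive (suc-injective (≡.sym (↭-length perm)))))
          skew few
          where
          perm : v ∷ xs ++ ys ↭ a ∷ b ∷ A
          perm = subst (v ∷ xs ++ ys ↭_) (≡.sym eq) (↭.↭-sym (shift v xs ys))

    -- Suppose `det a b` vanishes. If `b` is zero, then `0 a + 1 b` is a nontrivial relation;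
    -- otherwise some `b i` is nonzero and `(b i) a - (a i) b` is one.
    Independent⇒Skew : ∀ {A} → Independent 2 A → AllPairs Skew A
    Independent⇒Skew {[]}    _   = []
    Independent⇒Skew {a ∷ A} ind = All.tabulate skew ∷ Independent⇒Skew (Independent-tail ind)
      where
      skew : ∀ {b} → b ∈ A → Skew a b
      skew {b} b∈A ab≈0 with em {b ≈ᵥ 0ᵥ}
      ... | yes b≈0 = ind V.refl (use 0# (Combination-resp
              (V.trans (λ i → K.trans (K.*-congˡ (b≈0 i)) (K.zeroʳ 1#)) (0-multiple 0ᵥ a))
              (singleton≉ b∈A 1≉0)))
      ... | no b≉0 with i , bi≉0 ← nonzeroCoordinate b≉0 =
              ind V.refl (use≉ (b i) bi≉0 (Combination-resp (λ j → proportional i j) (singleton b∈A (- a i))))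
        where
        minors : ∀ i j → a i ⊠ b j ≈ b i ⊠ a j
        minors zero       zero       = K.*-comm (x₀ a) (x₀ b)
        minors zero       (suc zero) = K.trans (x∙y⁻¹≈ε⇒x≈y _ _ ab≈0) (K.*-comm (x₁ a) (x₀ b))
        minors (suc zero) zero       = K.trans (K.sym (x∙y⁻¹≈ε⇒x≈y _ _ ab≈0)) (K.*-comm (x₀ a) (x₁ b))
        minors (suc zero) (suc zero) = K.*-comm (x₁ a) (x₁ b)
        proportional : ∀ i j → (- a i) ⊠ b j ≈ 0# − b i ⊠ a j
        proportional i j = K.trans
          (solve 2 (λ x y → (:- x) :* y := con 0ℤ :- x :* y) K.refl (a i) (b j))
          (K.+-congˡ (K.-‿cong (minors i j)))

  -- Induction on the dimension.

  Rich : ℕ → Set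
  Rich n = Σ[ c ∈ ℕ ] (∀ A → Independent n A → Σ[ L ∈ SumList A ] length A ^ suc n ≤ c * size L)

  -- The exponent 2 and the factor 32 belong to the values of `det v` on the line; 1 bounds the cube
  -- of the length of a list with at most one member.
  rich-2 : Rich 2
  rich-2 = growthConstant 2 32 1 , λ A ind →
    Induction.many-sums (space 2) Plane.reduction A (Plane.Independent⇒Skew ind)

  -- Projection along v away from coordinate j, scaled by v j.
  module Projection {n} (v : Vec (suc n)) (j : Fin (suc n)) (vj≉0 : v j ≉ 0#) where
    project : Vec (suc n) → Vec n
    project x k = v j ⊠ x (punchIn j k) − x j ⊠ v (punchIn j k)

    project-cong : ∀ {x y} → x ≈ᵥ y → project x ≈ᵥ project y
    project-cong x≈y k = K.+-cong (K.*-congˡ (x≈y (punchIn j k))) (K.-‿cong (K.*-congʳ (x≈y j)))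

    project-+ : ∀ x y → project (x +ᵥ y) ≈ᵥ project x +ᵥ project y
    project-+ x y k = solve 6 (λ p q x₀ x₁ y₀ y₁ →
      p :* (x₀ :+ y₀) :- (x₁ :+ y₁) :* q := (p :* x₀ :- x₁ :* q) :+ (p :* y₀ :- y₁ :* q))
      K.refl (v j) (v (punchIn j k)) (x (punchIn j k)) (x j) (y (punchIn j k)) (y j)

    project-* : ∀ c x → project (c *ᵥ x) ≈ᵥ c *ᵥ project x
    project-* c x k = solve 5 (λ c p q x₀ x₁ →
      p :* (c :* x₀) :- (c :* x₁) :* q := c :* (p :* x₀ :- x₁ :* q))
      K.refl c (v j) (v (punchIn j k)) (x (punchIn j k)) (x j)

    project-v : project v ≈ᵥ 0ᵥ
    project-v k = K.-‿inverseʳ (v j ⊠ v (punchIn j k))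

    -- Off coordinate `j` the equation is the vanishing of a coordinate of the projection; at `j` it
    -- is commutativity.
    kernel : ∀ {x} → project x ≈ᵥ 0ᵥ → v j *ᵥ x ≈ᵥ x j *ᵥ v
    kernel {x} px≈0 k with j Fin.≟ k
    ... | yes ≡.refl = K.*-comm (v j) (x j)
    ... | no  j≢k    = subst (λ k → v j ⊠ x k ≈ x j ⊠ v k) (Fin.punchIn-punchOut j≢k)
                         (x∙y⁻¹≈ε⇒x≈y _ _ (px≈0 (punchOut j≢k)))

    projection : Homomorphism (space (suc n)) (space n)
    projection = record { φ = project ; φ-cong = project-cong ; φ-homo = project-+ }

    open SumsAlong projection using (φ-ε; module Kernel) public

    add-subtract : ∀ u c (a : Vec (suc n)) → u ≈ᵥ (u +ᵥ c *ᵥ a) -ᵥ c *ᵥ a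
    add-subtract u c a = V.sym (AbelianGroupProperties.//-rightDividesʳ (space (suc n)) (c *ᵥ a) u)

    project-add : ∀ {w} u c a → project u ≈ᵥ w -ᵥ c *ᵥ project a → project (u +ᵥ c *ᵥ a) ≈ᵥ w
    project-add {w} u c a e = V.trans (project-+ u (c *ᵥ a)) (V.trans
      (V.∙-cong e (project-* c a))
      (AbelianGroupProperties.//-rightDividesˡ (space n) (c *ᵥ project a) w))

    Combination-pullback : ∀ {b k} A {w} → Combination b k (map project A) w →
      ∃[ u ] (Combination b k A u × project u ≈ᵥ w)
    Combination-pullback [] ([] w≈0) = 0ᵥ , [] V.refl , V.trans φ-ε (V.sym w≈0)
    Combination-pullback (a ∷ A) (skip p) with u , q , e ← Combination-pullback A p = u , skip q , e
    Combination-pullback (a ∷ A) (use c p) with u , q , e ← Combination-pullback A p =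
      u +ᵥ c *ᵥ a , use c (Combination-resp (add-subtract u c a) q) , project-add u c a e
    Combination-pullback (a ∷ A) (use≉ c c≉0 p) with u , q , e ← Combination-pullback A p =
      u +ᵥ c *ᵥ a , use≉ c c≉0 (Combination-resp (add-subtract u c a) q) , project-add u c a e

    -- A relation among the projections lifts to a combination `u` of `A` in the kernel, where
    -- `(v j) u = (u j) v`. Scaling by `v j` and adding `v` with coefficient `- u j` gives a
    -- relation on one more position; its certified nonzero coefficient still lies in `A`.
    Independent-project : ∀ {A} → Independent (suc n) (v ∷ A) → Independent n (map project A)
    Independent-project {A} ind w≈0 p with u , q , e ← Combination-pullback A p =
      ind V.refl (use (- u j) (Combination-resp
        (λ k → K.trans (kernel {u} (V.trans e w≈0) k)
          (solve 2 (λ x y → x :* y := con 0ℤ :- (:- x) :* y) K.refl (u j) (v k)))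
        (scale vj≉0 q)))

  -- Lists of fewer than d vectors are vacuously independent and may even consist
  -- of zero vectors; the summand d ^ (d + 1) of the constant absorbs them.
  rich-suc : ∀ n → Rich (suc n) → Rich (suc (suc n))
  rich-suc n (c , rich) = growthConstant d c (d ^ suc d) , λ A ind →
    many-sums reduction A ind
    where
    d = suc (suc n)
    open Induction (space d)
    reduction : ∀ A → Independent d A → length A ^ suc d ≤ d ^ suc d ⊎ Reduction (Independent d) d c A
    reduction []      _   = inj₁ z≤n
    reduction (v ∷ A) ind = [ (λ le → inj₁ (^-monoˡ-≤ (suc d) le)) , (λ d≤ → inj₂ (reduce d≤)) ]′ (≤-total (suc (length A)) d)
      where
      reduce : d ≤ suc (length A) → Reduction (Independent d) d c (v ∷ A)
      reduce (s≤s le) = record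
        { v        = v
        ; rest     = A
        ; v∷rest↭A = ↭.refl
        ; Q-rest   = Independent-tail ind
        ; nonempty = ≤-trans (s≤s z≤n) le
        ; gain     = SubsetSums.size (proj₁ image)
        ; bound    = subst (λ m → m ^ d ≤ c * SubsetSums.size (proj₁ image)) (length-map project A) (proj₂ image)
        ; extend   = λ L → ⟨v⟩.extend L (proj₁ image)
        }
        where
        -- A zero `v` with coefficient 1, padded by vanishing coefficients on `suc n` positions of
        -- `A`, would be a nontrivial relation; `le` says that `A` has that many positions.
        v≉0 : v ≉ᵥ 0ᵥ
        v≉0 v≈0 = ind V.refl (use≉ 1# 1≉0 (Combination-resp
          (λ i → K.sym (K.trans (K.+-congˡ (K.-‿cong (K.*-congˡ (v≈0 i))))
            (solve 1 (λ x → con 0ℤ :- x :* con 0ℤ := con 0ℤ) K.refl 1#)))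
          (zeroCombination (suc n) A le)))
        j    = proj₁ (nonzeroCoordinate v≉0)
        vj≉0 = proj₂ (nonzeroCoordinate v≉0)
        open Projection v j vj≉0
        module ⟨v⟩ = Kernel em v project-v (torsionFreeᵥ j vj≉0)
        image = rich (map project A) (Independent-project ind)

  -- The induction starts in the plane: on the line `Independent 1` only excludes zero, so projected
  -- values could coincide.
  rich : ∀ n → Rich (suc (suc n))
  rich zero    = rich-2
  rich (suc n) = rich-suc (suc n) (rich n)

  -- From lists back to indexed families.

  open RawMonoidDefs K.+-rawMonoid using (sum)

  subsetTotal : ∀ {n m} → (Fin m → Vec n) → Subset m → Vec n
  subsetTotal a B j = sum (λ i → if lookup B i then a i j else 0#)

  subtract⇒add : ∀ x y {z} → x − y ≈ z → x ≈ y ⊞ z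
  subtract⇒add x y e = K.trans (solve 2 (λ x y → x := y :+ (x :- y)) K.refl x y) (K.+-congˡ e)

  SumOf⇒subsetTotal : ∀ {n m} (a : Fin m → Vec n) {s} → S.SumOf (tabulate a) s →
    ∃[ B ] s ≈ᵥ subsetTotal a B
  SumOf⇒subsetTotal {m = zero}  a p = [] , p
  SumOf⇒subsetTotal {m = suc m} a (inj₁ p) with B , e ← SumOf⇒subsetTotal (a ∘ suc) p =
    outside ∷ B , λ j → K.trans (e j) (K.sym (K.+-identityˡ _))
  SumOf⇒subsetTotal {m = suc m} a {s} (inj₂ p) with B , e ← SumOf⇒subsetTotal (a ∘ suc) p =
    inside ∷ B , λ j → subtract⇒add (s j) (a zero j) (e j)

  -- The nonzero coefficient is conditional on the flag, so that one recursion serves both flags: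
  -- below a `use≉` the flag may be `false`.
  Combination⇒subsetTotal : ∀ {n m b k} (a : Fin m → Vec n) {w} → Combination b k (tabulate a) w →
    ∃[ B ] (Subset.∣ B ∣ ≡ k × Σ[ c ∈ (Fin m → F) ]
      ((b ≡ true → ∃[ i ] (i Subset.∈ B × c i ≉ 0#)) × w ≈ᵥ subsetTotal (λ i → c i *ᵥ a i) B))
  Combination⇒subsetTotal {m = zero} a ([] w≈0) = [] , ≡.refl , (λ ()) , (λ ()) , w≈0
  Combination⇒subsetTotal {m = suc m} a (skip p)
    with B , card , c , nonzero , e ← Combination⇒subsetTotal (a ∘ suc) p =
      -- The skipped position lies outside the subset, so its coefficient `0#` is a placeholder.
      outside ∷ B , card , 0# Vector.∷ c
    , (λ b≡true → let i , i∈B , ci≉0 = nonzero b≡true in suc i , there i∈B , ci≉0)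
    , λ j → K.trans (e j) (K.sym (K.+-identityˡ _))
  Combination⇒subsetTotal {m = suc m} a {w} (use c₀ p)
    with B , card , c , nonzero , e ← Combination⇒subsetTotal (a ∘ suc) p =
      inside ∷ B , cong suc card , c₀ Vector.∷ c
    , (λ b≡true → let i , i∈B , ci≉0 = nonzero b≡true in suc i , there i∈B , ci≉0)
    , λ j → subtract⇒add (w j) (c₀ ⊠ a zero j) (e j)
  Combination⇒subsetTotal {m = suc m} a {w} (use≉ c₀ c₀≉0 p)
    with B , card , c , _ , e ← Combination⇒subsetTotal (a ∘ suc) p =
      inside ∷ B , cong suc card , c₀ Vector.∷ c
    , (λ _ → zero , here , c₀≉0)
    , λ j → subtract⇒add (w j) (c₀ ⊠ a zero j) (e j)

  independent : ∀ {n m} (a : Fin m → Vec n) →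
    (∀ B → Subset.∣ B ∣ ≡ n → ¬ (Σ[ c ∈ (Fin m → F) ]
      ((∃[ i ] (i Subset.∈ B × c i ≉ 0#)) × subsetTotal (λ i → c i *ᵥ a i) B ≈ᵥ 0ᵥ))) →
    Independent n (tabulate a)
  independent a ¬dependent w≈0 p with B , card , c , nonzero , e ← Combination⇒subsetTotal a p =
    ¬dependent B card (c , nonzero ≡.refl , V.trans (V.sym e) w≈0)

  record Sums {n m} (a : Fin m → Vec n) (C : ℕ) : Set where
    field
      count     : ℕ
      value     : Fin count → Vec n
      injective : ∀ {i j} → value i ≈ᵥ value j → i ≡ j
      isSum     : ∀ i → ∃[ B ] value i ≈ᵥ subsetTotal a B
      bound     : m ^ suc n ≤ C * count

  many-subsetTotals : ∀ n .{{_ : NonZero n}} → Σ[ C ∈ ℕ ] (∀ {m} (a : Fin m → Vec n) →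
    (∀ {i j} → a i ≈ᵥ a j → i ≡ j) → Independent n (tabulate a) → Sums a C)
  many-subsetTotals n = proj₁ (bounds n) , λ {m} a a-injective ind →
    let L , bound = proj₂ (bounds n) (tabulate a) (AllPairs.tabulate⁺ (_∘ a-injective)) ind in record
      { count     = size L
      ; value     = List.lookup (S.sums L)
      ; injective = λ {i} {j} → lookup-injective (λ {x} {y} → V.sym {n} {x} {y}) (S.distinct L) i j
      ; isSum     = λ i → SumOf⇒subsetTotal a (All.lookup (S.areSums L) (∈-lookup i))
      ; bound     = subst (λ k → k ^ suc n ≤ proj₁ (bounds n) * size L) (length-tabulate a) bound
      }
    where
    bounds : ∀ n .{{_ : NonZero n}} → Σ[ c ∈ ℕ ] (∀ A → AllPairs _≉ᵥ_ A → Independent n A →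
      Σ[ L ∈ SumList A ] length A ^ suc n ≤ c * size L)
    bounds (suc zero)    = 8 , Line.many-sums
    bounds (suc (suc n)) = proj₁ (rich n) , λ A _ → proj₂ (rich n) A

-- The reals as an ordered ring.

module Reals where
  open import Data.Nat.Base using (_≤_; _⊔_)
  open import Data.Nat.Properties
  open import Data.Rational.Base using (∣_∣)
  open import Defs as ℝ using (ℝ; mkℝ; seq; cauchy; Cauchy; fromℚ; 0ℝ)
  open ℚSolver.+-*-Solver

  ½-pos : ∀ {ε} → 0ℚ ℚ.< ε → 0ℚ ℚ.< ½ ℚ.* ε
  ½-pos {ε} 0<ε = ℚ.positive⁻¹ (½ ℚ.* ε) {{ℚ.pos*pos⇒pos ½ ε {{ℚ.positive 0<ε}}}}

  ½+½ : ∀ ε → ½ ℚ.* ε ℚ.+ ½ ℚ.* ε ≡ ε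
  ½+½ ε = ≡.trans (≡.sym (ℚ.*-distribʳ-+ ε ½ ½)) (ℚ.*-identityˡ ε)

  p≤∣p∣ : ∀ p → p ℚ.≤ ∣ p ∣
  p≤∣p∣ p with ℚ.∣p∣≡p∨∣p∣≡-p p
  ... | inj₁ e = ℚ.≤-reflexive (≡.sym e)
  ... | inj₂ e = ℚ.≤-trans p≤0 (ℚ.0≤∣p∣ p)
    where
    p≤0 : p ℚ.≤ 0ℚ
    p≤0 = subst (ℚ._≤ 0ℚ) (solve 1 (λ p → :- (:- p) := p) ≡.refl p)
      (ℚ.neg-antimono-≤ (subst (0ℚ ℚ.≤_) e (ℚ.0≤∣p∣ p)))

  -- Equality of reals unfolds to `Null` of the termwise difference, so the congruence laws become
  -- closure properties of null sequences.
  Null : (ℕ → ℚ) → Set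
  Null s = ∀ ε → 0ℚ ℚ.< ε → ∃[ N ] ∀ n → N ≤ n → ∣ s n ∣ ℚ.< ε

  EventuallyBounded : (ℕ → ℚ) → Set
  EventuallyBounded s = Σ[ b ∈ ℚ ] (0ℚ ℚ.< b × ∃[ N ] ∀ n → N ≤ n → ∣ s n ∣ ℚ.≤ b)

  Null-resp : ∀ {s t} → (∀ n → s n ≡ t n) → Null s → Null t
  Null-resp s≗t null ε 0<ε with N , p ← null ε 0<ε =
    N , λ n le → subst (λ x → ∣ x ∣ ℚ.< ε) (s≗t n) (p n le)

  Null-0 : ∀ {s} → (∀ n → s n ≡ 0ℚ) → Null s
  Null-0 s≗0 ε 0<ε = 0 , λ n _ → subst (λ x → ∣ x ∣ ℚ.< ε) (≡.sym (s≗0 n)) 0<ε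

  Null-neg : ∀ {s} → Null s → Null (λ n → ℚ.- s n)
  Null-neg {s} null ε 0<ε with N , p ← null ε 0<ε =
    N , λ n le → subst (ℚ._< ε) (≡.sym (ℚ.∣-p∣≡∣p∣ (s n))) (p n le)

  Null-+ : ∀ {s t} → Null s → Null t → Null (λ n → s n ℚ.+ t n)
  Null-+ {s} {t} ns nt ε 0<ε
    with M , p ← ns (½ ℚ.* ε) (½-pos 0<ε) | N , q ← nt (½ ℚ.* ε) (½-pos 0<ε) =
    M ⊔ N , λ n le → begin-strict
      ∣ s n ℚ.+ t n ∣          ≤⟨ ℚ.∣p+q∣≤∣p∣+∣q∣ (s n) (t n) ⟩
      ∣ s n ∣ ℚ.+ ∣ t n ∣      <⟨ ℚ.+-mono-< (p n (m⊔n≤o⇒m≤o M N le)) (q n (m⊔n≤o⇒n≤o M N le)) ⟩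
      ½ ℚ.* ε ℚ.+ ½ ℚ.* ε      ≡⟨ ½+½ ε ⟩
      ε                        ∎
    where open ℚ.≤-Reasoning

  divide : ∀ {b ε} → 0ℚ ℚ.< b → 0ℚ ℚ.< ε → Σ[ δ ∈ ℚ ] (0ℚ ℚ.< δ × b ℚ.* δ ≡ ε)
  divide {b} {ε} 0<b 0<ε =
      (ℚ.1/ b) ℚ.* ε
    , ℚ.positive⁻¹ _ {{ℚ.pos*pos⇒pos (ℚ.1/ b) {{ℚ.1/pos⇒pos b {{ℚ.positive 0<b}}}} ε {{ℚ.positive 0<ε}}}}
    , ≡.trans (≡.sym (ℚ.*-assoc b (ℚ.1/ b) ε))
        (≡.trans (cong (ℚ._* ε) (ℚ.*-inverseʳ b)) (ℚ.*-identityˡ ε))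
    where instance b≢0 = ℚ.pos⇒nonZero b {{ℚ.positive 0<b}}

  Null-*ˡ : ∀ {s t} → EventuallyBounded s → Null t → Null (λ n → s n ℚ.* t n)
  Null-*ˡ {s} {t} (b , 0<b , M , bounded) nt ε 0<ε
    with δ , 0<δ , bδ≡ε ← divide 0<b 0<ε
    with N , p ← nt δ 0<δ = M ⊔ N , λ n le → begin-strict
      ∣ s n ℚ.* t n ∣      ≡⟨ ℚ.∣p*q∣≡∣p∣*∣q∣ (s n) (t n) ⟩
      ∣ s n ∣ ℚ.* ∣ t n ∣  ≤⟨ ℚ.*-monoʳ-≤-nonNeg ∣ t n ∣ {{ℚ.∣-∣-nonNeg (t n)}} (bounded n (m⊔n≤o⇒m≤o M N le)) ⟩
      b ℚ.* ∣ t n ∣        <⟨ ℚ.*-monoʳ-<-pos b {{ℚ.positive 0<b}} (p n (m⊔n≤o⇒n≤o M N le)) ⟩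
      b ℚ.* δ              ≡⟨ bδ≡ε ⟩
      ε                    ∎
    where open ℚ.≤-Reasoning

  Cauchy⇒bounded : ∀ {s} → Cauchy s → EventuallyBounded s
  Cauchy⇒bounded {s} cs with N , p ← cs 1ℚ (ℚ.positive⁻¹ 1ℚ) =
    1ℚ ℚ.+ ∣ s N ∣ , ℚ.+-mono-<-≤ (ℚ.positive⁻¹ 1ℚ) (ℚ.0≤∣p∣ (s N)) , N , λ n le → begin
      ∣ s n ∣                          ≡⟨ cong ∣_∣ (solve 2 (λ x y → x := (x :- y) :+ y) ≡.refl (s n) (s N)) ⟩
      ∣ (s n ℚ.- s N) ℚ.+ s N ∣        ≤⟨ ℚ.∣p+q∣≤∣p∣+∣q∣ (s n ℚ.- s N) (s N) ⟩
      ∣ s n ℚ.- s N ∣ ℚ.+ ∣ s N ∣      ≤⟨ ℚ.+-monoˡ-≤ ∣ s N ∣ (ℚ.<⇒≤ (p n N le ≤-refl)) ⟩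
      1ℚ ℚ.+ ∣ s N ∣                   ∎
    where open ℚ.≤-Reasoning

  -ℝ_ : ℝ → ℝ
  -ℝ x = mkℝ (λ n → ℚ.- seq x n) λ ε 0<ε →
    let N , p = cauchy x ε 0<ε in
    N , λ m n hm hn → subst (ℚ._< ε)
      (≡.trans (≡.sym (ℚ.∣-p∣≡∣p∣ (seq x m ℚ.- seq x n)))
        (cong ∣_∣ (solve 2 (λ x y → :- (x :- y) := :- x :- :- y) ≡.refl (seq x m) (seq x n))))
      (p m n hm hn)

  ≗⇒≈ : ∀ {x y} → (∀ n → seq x n ≡ seq y n) → x ℝ.≈ y
  ≗⇒≈ {x} {y} x≗y = Null-0 λ n → ≡.trans (cong (ℚ._- seq y n) (x≗y n)) (ℚ.+-inverseʳ (seq y n))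

  abstract
    +-cong-ℝ : ∀ {x y u v} → x ℝ.≈ y → u ℝ.≈ v → (x ℝ.+ u) ℝ.≈ (y ℝ.+ v)
    +-cong-ℝ {x} {y} {u} {v} x≈y u≈v = Null-resp
      (λ n → solve 4 (λ x y u v → (x :- y) :+ (u :- v) := (x :+ u) :- (y :+ v)) ≡.refl
        (seq x n) (seq y n) (seq u n) (seq v n))
      (Null-+ x≈y u≈v)

    *-cong-ℝ : ∀ {x y u v} → x ℝ.≈ y → u ℝ.≈ v → (x ℝ.* u) ℝ.≈ (y ℝ.* v)
    *-cong-ℝ {x} {y} {u} {v} x≈y u≈v = Null-resp
      (λ n → solve 4 (λ x y u v → u :* (x :- y) :+ y :* (u :- v) := x :* u :- y :* v) ≡.refl
        (seq x n) (seq y n) (seq u n) (seq v n))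
      (Null-+ (Null-*ˡ {seq u} (Cauchy⇒bounded (cauchy u)) x≈y) (Null-*ˡ {seq y} (Cauchy⇒bounded (cauchy y)) u≈v))

    neg-cong-ℝ : ∀ {x y} → x ℝ.≈ y → (-ℝ x) ℝ.≈ (-ℝ y)
    neg-cong-ℝ {x} {y} x≈y = Null-resp
      (λ n → solve 2 (λ x y → :- (x :- y) := :- x :- :- y) ≡.refl (seq x n) (seq y n))
      (Null-neg x≈y)

    ≈-sym : ∀ {x y} → x ℝ.≈ y → y ℝ.≈ x
    ≈-sym {x} {y} x≈y = Null-resp
      (λ n → solve 2 (λ x y → :- (x :- y) := y :- x) ≡.refl (seq x n) (seq y n)) (Null-neg x≈y)

    ≈-trans : ∀ {x y z} → x ℝ.≈ y → y ℝ.≈ z → x ℝ.≈ z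
    ≈-trans {x} {y} {z} x≈y y≈z = Null-resp
      (λ n → solve 3 (λ x y z → (x :- y) :+ (y :- z) := x :- z) ≡.refl (seq x n) (seq y n) (seq z n))
      (Null-+ x≈y y≈z)

  ℝ-commutativeRing : CommutativeRing 0ℓ 0ℓ
  ℝ-commutativeRing = record
    { Carrier = ℝ ; _≈_ = ℝ._≈_ ; _+_ = ℝ._+_ ; _*_ = ℝ._*_ ; -_ = -ℝ_ ; 0# = 0ℝ ; 1# = fromℚ 1ℚ
    ; isCommutativeRing = record
      { isRing = record
        { +-isAbelianGroup = record
          { isGroup = record
            { isMonoid = record
              { isSemigroup = record
                { isMagma = record
                  { isEquivalence = record
                    { refl  = λ {x} → ≗⇒≈ {x} {x} (λ _ → ≡.refl)
                    ; sym   = λ {x} {y} → ≈-sym {x} {y}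
                    ; trans = λ {x} {y} {z} → ≈-trans {x} {y} {z}
                    }
                  ; ∙-cong = λ {x} {y} {u} {v} → +-cong-ℝ {x} {y} {u} {v}
                  }
                ; assoc = λ x y z → ≗⇒≈ {(x ℝ.+ y) ℝ.+ z} {x ℝ.+ (y ℝ.+ z)} (λ n → ℚ.+-assoc (seq x n) (seq y n) (seq z n))
                }
              ; identity = (λ x → ≗⇒≈ {0ℝ ℝ.+ x} {x} (λ n → ℚ.+-identityˡ (seq x n)))
                         , (λ x → ≗⇒≈ {x ℝ.+ 0ℝ} {x} (λ n → ℚ.+-identityʳ (seq x n)))
              }
            ; inverse = (λ x → ≗⇒≈ {(-ℝ x) ℝ.+ x} {0ℝ} (λ n → ℚ.+-inverseˡ (seq x n)))
                      , (λ x → ≗⇒≈ {x ℝ.+ (-ℝ x)} {0ℝ} (λ n → ℚ.+-inverseʳ (seq x n)))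
            ; ⁻¹-cong = λ {x} {y} → neg-cong-ℝ {x} {y}
            }
          ; comm = λ x y → ≗⇒≈ {x ℝ.+ y} {y ℝ.+ x} (λ n → ℚ.+-comm (seq x n) (seq y n))
          }
        ; *-cong = λ {x} {y} {u} {v} → *-cong-ℝ {x} {y} {u} {v}
        ; *-assoc = λ x y z → ≗⇒≈ {(x ℝ.* y) ℝ.* z} {x ℝ.* (y ℝ.* z)} (λ n → ℚ.*-assoc (seq x n) (seq y n) (seq z n))
        ; *-identity = (λ x → ≗⇒≈ {fromℚ 1ℚ ℝ.* x} {x} (λ n → ℚ.*-identityˡ (seq x n)))
                     , (λ x → ≗⇒≈ {x ℝ.* fromℚ 1ℚ} {x} (λ n → ℚ.*-identityʳ (seq x n)))
        ; distrib = (λ x y z → ≗⇒≈ {x ℝ.* (y ℝ.+ z)} {x ℝ.* y ℝ.+ x ℝ.* z} (λ n → ℚ.*-distribˡ-+ (seq x n) (seq y n) (seq z n)))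
                  , (λ x y z → ≗⇒≈ {(y ℝ.+ z) ℝ.* x} {y ℝ.* x ℝ.+ z ℝ.* x} (λ n → ℚ.*-distribʳ-+ (seq x n) (seq y n) (seq z n)))
        }
      ; *-comm = λ x y → ≗⇒≈ {x ℝ.* y} {y ℝ.* x} (λ n → ℚ.*-comm (seq x n) (seq y n))
      }
    }

  -- Half of the uniform gap `ε` survives a null perturbation, so positivity respects equality of
  -- reals.
  PosSeq : (ℕ → ℚ) → Set
  PosSeq s = Σ[ ε ∈ ℚ ] (0ℚ ℚ.< ε × ∃[ N ] ∀ n → N ≤ n → ε ℚ.≤ s n)

  p-∣p-q∣≤q : ∀ {p q ε δ} → ε ℚ.≤ p → ∣ p ℚ.- q ∣ ℚ.< δ → ε ℚ.- δ ℚ.≤ q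
  p-∣p-q∣≤q {p} {q} {ε} {δ} ε≤p close = begin
    ε ℚ.- δ              ≤⟨ ℚ.+-mono-≤ ε≤p (ℚ.neg-antimono-≤ (ℚ.≤-trans (p≤∣p∣ (p ℚ.- q)) (ℚ.<⇒≤ close))) ⟩
    p ℚ.- (p ℚ.- q)      ≡⟨ solve 2 (λ p q → p :- (p :- q) := q) ≡.refl p q ⟩
    q                    ∎
    where open ℚ.≤-Reasoning

  ε-½ε : ∀ ε → ε ℚ.- ½ ℚ.* ε ≡ ½ ℚ.* ε
  ε-½ε ε = ≡.trans (cong (ℚ._- ½ ℚ.* ε) (≡.sym (½+½ ε)))
    (solve 1 (λ h → (h :+ h) :- h := h) ≡.refl (½ ℚ.* ε))

  PosSeq-resp : ∀ {s t} → Null (λ n → s n ℚ.- t n) → PosSeq s → PosSeq t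
  PosSeq-resp {s} {t} null (ε , 0<ε , M , p) with N , q ← null (½ ℚ.* ε) (½-pos 0<ε) =
    ½ ℚ.* ε , ½-pos 0<ε , M ⊔ N , λ n le → subst (ℚ._≤ t n) (ε-½ε ε)
      (p-∣p-q∣≤q (p n (m⊔n≤o⇒m≤o M N le)) (q n (m⊔n≤o⇒n≤o M N le)))

  PosSeq-+ : ∀ {s t} → PosSeq s → PosSeq t → PosSeq (λ n → s n ℚ.+ t n)
  PosSeq-+ (ε , 0<ε , M , p) (δ , 0<δ , N , q) =
    ε ℚ.+ δ , ℚ.+-mono-< 0<ε 0<δ , M ⊔ N , λ n le →
      ℚ.+-mono-≤ (p n (m⊔n≤o⇒m≤o M N le)) (q n (m⊔n≤o⇒n≤o M N le))

  PosSeq-* : ∀ {s t} → PosSeq s → PosSeq t → PosSeq (λ n → s n ℚ.* t n)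
  PosSeq-* {s} {t} (ε , 0<ε , M , p) (δ , 0<δ , N , q) =
      ε ℚ.* δ
    , ℚ.positive⁻¹ (ε ℚ.* δ) {{ℚ.pos*pos⇒pos ε {{ℚ.positive 0<ε}} δ {{ℚ.positive 0<δ}}}}
    , M ⊔ N , λ n le → ℚ.≤-trans
        (ℚ.*-monoˡ-≤-nonNeg ε {{ℚ.nonNegative (ℚ.<⇒≤ 0<ε)}} (q n (m⊔n≤o⇒n≤o M N le)))
        (ℚ.*-monoʳ-≤-nonNeg (t n) {{ℚ.nonNegative (ℚ.≤-trans (ℚ.<⇒≤ 0<δ) (q n (m⊔n≤o⇒n≤o M N le)))}} (p n (m⊔n≤o⇒m≤o M N le)))

  PosSeq⇒¬Null : ∀ {s} → PosSeq s → ¬ Null s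
  PosSeq⇒¬Null {s} (ε , 0<ε , M , p) null with N , q ← null ε 0<ε =
    ℚ.<-irrefl ≡.refl (ℚ.≤-<-trans (ℚ.≤-trans (p (M ⊔ N) (m≤m⊔n M N)) (p≤∣p∣ (s (M ⊔ N)))) (q (M ⊔ N) (m≤n⊔m M N)))

  -- Past the index where terms differ by less than `½ ε`, one term of size `ε` keeps all the others
  -- above `½ ε`.
  large⇒PosSeq : ∀ {s ε} → Cauchy s → 0ℚ ℚ.< ε →
    ∃[ N ] ∀ n → N ≤ n → ε ℚ.≤ s n → PosSeq s
  large⇒PosSeq {s} {ε} cs 0<ε with N , close ← cs (½ ℚ.* ε) (½-pos 0<ε) =
    N , λ n N≤n ε≤sn → ½ ℚ.* ε , ½-pos 0<ε , N , λ m N≤m →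
      subst (ℚ._≤ s m) (ε-½ε ε) (p-∣p-q∣≤q ε≤sn (close n m N≤n N≤m))

  -- A late term of absolute value at least `ε` would make the sequence or its negative positive by
  -- `large⇒PosSeq`.
  neither⇒Null : ∀ x → ¬ PosSeq (seq x) → ¬ PosSeq (seq (-ℝ x)) → Null (seq x)
  neither⇒Null x ¬pos ¬neg ε 0<ε = combine (large⇒PosSeq (cauchy x) 0<ε) (large⇒PosSeq (cauchy (-ℝ x)) 0<ε)
    where
    combine : (∃[ N ] ∀ n → N ≤ n → ε ℚ.≤ seq x n → PosSeq (seq x)) →
      (∃[ N ] ∀ n → N ≤ n → ε ℚ.≤ ℚ.- seq x n → PosSeq (seq (-ℝ x))) →
      ∃[ N ] ∀ n → N ≤ n → ∣ seq x n ∣ ℚ.< ε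
    combine (M , p) (N , q) = M ⊔ N , λ n le → ℚ.≰⇒> λ ε≤∣x∣ →
      [ (λ e → ¬pos (p n (m⊔n≤o⇒m≤o M N le) (subst (ε ℚ.≤_) e ε≤∣x∣)))
      , (λ e → ¬neg (q n (m⊔n≤o⇒n≤o M N le) (subst (ε ℚ.≤_) e ε≤∣x∣)))
      ]′ (ℚ.∣p∣≡p∨∣p∣≡-p (seq x n))

  x-0≡x : ∀ p → p ℚ.- 0ℚ ≡ p
  x-0≡x = ℚ.+-identityʳ

  ℝ-cone : ExcludedMiddle 0ℓ → PositiveCone (CommutativeRing.+-abelianGroup ℝ-commutativeRing)
  ℝ-cone em = record
    { Pos       = λ x → PosSeq (seq x)
    ; Pos-resp  = PosSeq-resp
    ; Pos-∙     = PosSeq-+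
    ; Pos⇒≉ε    = λ {x} p x≈0 → PosSeq⇒¬Null p (Null-resp (λ n → x-0≡x (seq x n)) x≈0)
    ; Pos-total = λ {x} x≉0 → total x x≉0
    }
    where
    total : ∀ x → ¬ (x ℝ.≈ 0ℝ) → PosSeq (seq x) ⊎ PosSeq (seq (-ℝ x))
    total x x≉0 with em {PosSeq (seq x)} | em {PosSeq (seq (-ℝ x))}
    ... | yes p | _     = inj₁ p
    ... | no  _ | yes q = inj₂ q
    ... | no ¬p | no ¬q = contradiction (Null-resp (λ n → ≡.sym (x-0≡x (seq x n))) (neither⇒Null x ¬p ¬q)) x≉0

  ℝ-orderedRing : ExcludedMiddle 0ℓ → OrderedRing
  ℝ-orderedRing em = record
    { ring  = ℝ-commutativeRing
    ; cone  = ℝ-cone em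
    ; Pos-* = λ {x} {y} → PosSeq-* {seq x} {seq y}
    ; 1≉0   = PositiveCone.Pos⇒≉ε (ℝ-cone em) {fromℚ 1ℚ} (1ℚ , ℚ.positive⁻¹ 1ℚ , 0 , λ _ _ → ℚ.≤-refl)
    }

-- The constant and the bound over the reals.

open import Data.Fin.Subset using (∣_∣)
open import Data.Integer.Base using (+_)
open import Defs

-- The successor keeps the denominator nonzero; enlarging the integer constant by one only weakens
-- the bound.
reciprocal : ℕ → ℚ
reciprocal c = + 1 ℚ./ suc c

0<reciprocal : ∀ c → 0ℚ ℚ.< reciprocal c
0<reciprocal c = ℚ.toℚᵘ-cancel-< (ℚᵘ.<-respʳ-≃ (ℚᵘ.≃-sym (ℚ.toℚᵘ-fromℚᵘ (mkℚᵘ (+ 1) c)))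
  (*<* (ℤ.+<+ (s≤s z≤n))))

-- For unnormalised fractions the inequality is cross multiplication, which gives back the
-- hypothesis on naturals.
reciprocal-*-≤ : ∀ c m n → m ℕ.≤ suc c ℕ.* n → reciprocal c ℚ.* (+ m ℚ./ 1) ℚ.≤ + n ℚ./ 1
reciprocal-*-≤ c m n m≤ = ℚ.toℚᵘ-cancel-≤ (begin
  ℚ.toℚᵘ (reciprocal c ℚ.* (+ m ℚ./ 1))             ≃⟨ ℚ.toℚᵘ-homo-* (reciprocal c) (+ m ℚ./ 1) ⟩
  ℚ.toℚᵘ (reciprocal c) ℚᵘ.* ℚ.toℚᵘ (+ m ℚ./ 1)     ≃⟨ ℚᵘ.*-cong (ℚ.toℚᵘ-fromℚᵘ (mkℚᵘ (+ 1) c)) (ℚ.toℚᵘ-fromℚᵘ (mkℚᵘ (+ m) 0)) ⟩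
  mkℚᵘ (+ 1) c ℚᵘ.* mkℚᵘ (+ m) 0            ≤⟨ *≤* cleared ⟩
  mkℚᵘ (+ n) 0                              ≃⟨ ℚ.toℚᵘ-fromℚᵘ (mkℚᵘ (+ n) 0) ⟨
  ℚ.toℚᵘ (+ n ℚ./ 1)                        ∎)
  where
  open ℚᵘ.≤-Reasoning
  cleared : (+ 1 ℤ.* + m) ℤ.* + 1 ℤ.≤ + n ℤ.* + (suc c ℕ.* 1)
  cleared = subst₂ ℤ._≤_
    (≡.sym (≡.trans (ℤ.*-identityʳ (+ 1 ℤ.* + m)) (ℤ.*-identityˡ (+ m))))
    (≡.trans (cong +_ (≡.trans (ℕ.*-comm (suc c) n) (cong (n ℕ.*_) (≡.sym (ℕ.*-identityʳ (suc c)))))) (ℤ.pos-* n (suc c ℕ.* 1)))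
    (ℤ.+≤+ m≤)

0<fromℚ-reciprocal : ∀ c → 0ℝ < fromℚ (reciprocal c)
0<fromℚ-reciprocal c = reciprocal c , 0<reciprocal c , 0 , λ _ _ → ℚ.≤-reflexive (ℚ.+-identityˡ (reciprocal c))

fromℚ-*-≤ : ∀ q m n → q ℚ.* (+ m ℚ./ 1) ℚ.≤ + n ℚ./ 1 → fromℚ q * fromℕ m ≤ fromℕ n
fromℚ-*-≤ q m n le (ε , 0<ε , N , p) = ℚ.<-irrefl ≡.refl (begin-strict
  + n ℚ./ 1            ≡⟨ ℚ.+-identityʳ (+ n ℚ./ 1) ⟨
  + n ℚ./ 1 ℚ.+ 0ℚ     <⟨ ℚ.+-monoʳ-< (+ n ℚ./ 1) 0<ε ⟩
  + n ℚ./ 1 ℚ.+ ε      ≤⟨ p N ℕ.≤-refl ⟩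
  q ℚ.* (+ m ℚ./ 1)    ≤⟨ le ⟩
  + n ℚ./ 1            ∎)
  where open ℚ.≤-Reasoning

theorem1p2 : ExcludedMiddle 0ℓ → (d : ℕ) → .{{NonZero d}} →
    Σ[ γ ∈ ℝ ] (0ℝ < γ ×
    ((m : ℕ) (A : Fin m → ℝ^ d) → Distinct A →
    ((B : Subset m) → ∣ B ∣ ≡ d → ¬ LinearlyDependent A B) →
    HasAtLeast (γ * fromℕ (m ^ suc d)) (IsSubsetSum A)))
theorem1p2 em d = fromℚ (reciprocal C) , 0<fromℚ-reciprocal C , bound
  where
  open Reals using (ℝ-orderedRing)
  module R = LinearAlgebra em (ℝ-orderedRing em)
  C = proj₁ (R.many-subsetTotals d)
  bound : (m : ℕ) (A : Fin m → ℝ^ d) → Distinct A →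
    ((B : Subset m) → ∣ B ∣ ≡ d → ¬ LinearlyDependent A B) →
    HasAtLeast (fromℚ (reciprocal C) * fromℕ (m ^ suc d)) (IsSubsetSum A)
  bound m A distinct independent =
      count
    , fromℚ-*-≤ (reciprocal C) (m ^ suc d) count (reciprocal-*-≤ C (m ^ suc d) count
        (ℕ.≤-trans many (ℕ.*-monoˡ-≤ count (ℕ.n≤1+n C))))
    , value , injective , isSum
    where open R.Sums (proj₂ (R.many-subsetTotals d) A distinct (R.independent A independent)) renaming (bound to many)
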